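{- Let $\nu$ be an integer partition. Then $q_\nu(\lambda)$ is a $D$-polynomial of degree at most $|\nu|/2$. Furthermore, there exist rational numbers $b_\delta$ (independent of $\lambda$), indexed by partitions $\delta$ with $|\delta|\le|\nu|-2$, such that $$D\Bigl(\frac{q_\nu(\lambda)}{H_\lambda}\Bigr)=\sum_{|\delta|\le|\nu|-2}b_\delta\frac{q_\delta(\lambda)}{H_\lambda}$$ for every partition $\lambda$.
   Context: Boxes of a Young diagram are indexed $(i,j)$ with row $i$ and column $j$; content is $j-i$. For a partition $\lambda$, let $(\alpha_1,\beta_1),\ldots,(\alpha_m,\beta_m)$ be the coordinates of its removable boxes (outer corners), ordered with $\alpha_1>\cdots>\alpha_m$; set $\alpha_{m+1}=\beta_0=0$. Define $x_i=\beta_i-\alpha_{i+1}$ ($0\le i\le m$) and $y_j=\beta_j-\alpha_j$ ($1\le j\le m$), and $q_k(\lambda)=\sum_{0\le i\le m}x_i^k-\sum_{1\le j\le m}y_j^k$ for $k\ge0$ (for $\lambda=\emptyset$: $m=0$, $x_0=0$). For a partition $\nu=(\nu_1,\ldots,\nu_\ell)$, $q_\nu=q_{\nu_1}\cdots q_{\nu_\ell}$ (with $q_\emptyset=1$). $h_\square$ is the hook length (arm + leg + 1), $H_\lambda=\prod_{\square\in\lambda}h_\square$, $H_\emptyset=1$. For a function $g$ on partitions, $Dg(\lambda)=\sum_{\lambda^+}g(\lambda^+)-g(\lambda)$, where $\lambda^+$ ranges over partitions obtained from $\lambda$ by adding one box; $D^0g=g$, $D^kg=D(D^{k-1}g)$.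 A function $g$ is a $D$-polynomial of degree at most $d$ if $D^{r+1}(g(\lambda)/H_\lambda)=0$ for all $\lambda$ for some integer $r\le d$. -}

module Defs where

open import Data.Bool using (Bool; true; false; if_then_else_)
open import Data.Nat as ℕ using (ℕ; zero; suc; _∸_; _≤ᵇ_; _<ᵇ_; NonZero)
open import Data.Nat.Properties using (m*n≢0)
open import Data.Integer as ℤ using (ℤ; +_)
open import Data.Rational as ℚ using (ℚ; 0ℚ; 1ℚ)
open import Data.List using (List; []; _∷_; map; _++_; length; filterᵇ; upTo; foldr; reverse)
open import Data.Nat.ListAction using (product)
open import Data.List.Relation.Unary.All using (All)
open import Data.List.Relation.Unary.Linked using (Linked)
open import Data.Product using (_×_; _,_)

IsPartition : List ℕ → Set
IsPartition λs = Linked ℕ._≥_ λs × All (ℕ._<_ 0) λs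

size : List ℕ → ℕ
size = foldr ℕ._+_ 0

-- corners in increasing row order: row i is a corner iff λ_i > λ_{i+1}
-- (λ_{ℓ+1} = 0); the corner box is (i, λ_i).
cornersAux : ℕ → List ℕ → List (ℕ × ℕ)
cornersAux i [] = []
cornersAux i (a ∷ []) = (i , a) ∷ []
cornersAux i (a ∷ b ∷ rest) =
  if b <ᵇ a then (i , a) ∷ cornersAux (suc i) (b ∷ rest)
            else cornersAux (suc i) (b ∷ rest)

-- removable boxes (α₁,β₁),…,(α_m,β_m) with α₁ > ⋯ > α_m
corners : List ℕ → List (ℕ × ℕ)
corners λs = reverse (cornersAux 1 λs)

-- x_i = β_i - α_{i+1}  (β₀ = 0, α_{m+1} = 0); first argument is β_i
xsAux : ℕ → List (ℕ × ℕ) → List ℤ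
xsAux β [] = (+ β ℤ.- + 0) ∷ []
xsAux β ((α , β′) ∷ rest) = (+ β ℤ.- + α) ∷ xsAux β′ rest

xs : List ℕ → List ℤ
xs λs = xsAux 0 (corners λs)

ys : List ℕ → List ℤ
ys λs = map (λ { (α , β) → + β ℤ.- + α }) (corners λs)

sumℤ : List ℤ → ℤ
sumℤ = foldr ℤ._+_ (+ 0)

productℤ : List ℤ → ℤ
productℤ = foldr ℤ._*_ (+ 1)

q : ℕ → List ℕ → ℤ
q k λs = sumℤ (map (λ x → x ℤ.^ k) (xs λs)) ℤ.- sumℤ (map (λ y → y ℤ.^ k) (ys λs))

qν : List ℕ → List ℕ → ℤ
qν ν λs = productℤ (map (λ k → q k λs) ν)

conj : List ℕ → ℕ → ℕ
conj λs j = length (filterᵇ (j ≤ᵇ_) λs)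

-- (arm + leg) for all boxes (i,j), i = row index (from 1), j = 1..λ_i
armLegs : List ℕ → ℕ → List ℕ → List ℕ
armLegs λs i [] = []
armLegs λs i (a ∷ rest) =
  map (λ j → (a ∸ j) ℕ.+ (conj λs j ∸ i)) (map suc (upTo a)) ++ armLegs λs (suc i) rest

hooks : List ℕ → List ℕ
hooks λs = map suc (armLegs λs 1 λs)

H : List ℕ → ℕ
H λs = product (hooks λs)

prodSuc-nonZero : (ns : List ℕ) → NonZero (product (map suc ns))
prodSuc-nonZero [] = _
prodSuc-nonZero (n ∷ ns) = m*n≢0 (suc n) _ {{_}} {{prodSuc-nonZero ns}}

H-nonZero : (λs : List ℕ) → NonZero (H λs)
H-nonZero λs = prodSuc-nonZero (armLegs λs 1 λs)

infixl 7 _/H_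
_/H_ : ℤ → List ℕ → ℚ
z /H λs = ℚ._/_ z (H λs) {{H-nonZero λs}}

-- all lists obtained from λ by adding one box (for a partition λ these
-- are exactly the partitions λ⁺, each listed once)
fits : ℕ → List ℕ → Bool
fits a [] = true
fits a (b ∷ _) = b ≤ᵇ a

adds : List ℕ → List (List ℕ)
adds [] = (1 ∷ []) ∷ []
adds (a ∷ rest) = (suc a ∷ rest) ∷ map (a ∷_) (filterᵇ (fits a) (adds rest))

sumℚ : List ℚ → ℚ
sumℚ = foldr ℚ._+_ 0ℚ

D : (List ℕ → ℚ) → (List ℕ → ℚ)
D g λs = sumℚ (map g (adds λs)) ℚ.- g λs

Dpow : ℕ → (List ℕ → ℚ) → (List ℕ → ℚ)
Dpow zero g = g
Dpow (suc k) g = D (Dpow k g)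

IsDPolyOfDegreeAtMostHalf : (List ℕ → ℤ) → ℕ → Set
IsDPolyOfDegreeAtMostHalf g n =
  Data.Product.∃ λ r → (2 ℕ.* r ℕ.≤ n) ×
    ((λs : List ℕ) → IsPartition λs → Dpow (suc r) (λ μ → g μ /H μ) λs ≡ 0ℚ)
  where open import Relation.Binary.PropositionalEquality using (_≡_)

{-# OPTIONS --safe #-}
-- Write g_μ = 1 / H_μ, and let row i of λ contribute the shifted part ℓ_i.  By the
-- formula H = Π ℓ_i! / Π (ℓ_i - ℓ_j), the ratio g_μ / g_λ for μ = λ plus a box in row i
-- is a residue of Π (z - y) / Π (z - x) at the content of the new box, where x and y run
-- over the contents next to and at the ends of all rows (not only of the corners: rows
-- that cannot be extended get weight 0).  Hence the moments Σ_μ x^k g_μ / g_λ are the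
-- complete symmetric functions whose power sums are the q_k, and by Newton's identities
-- they are polynomials in the q's, homogeneous of degree k.  Adding a box of content x
-- changes q_k by (x + 1)^k + (x - 1)^k - 2 x^k, of degree k - 2 in x; expanding the product
-- q_ν and summing over x turns each monomial into an element of degree at most |ν| - 2.
-- Iterating lowers the degree by 2 each time.
module Submission where

open import Defs
open import Algebra.Bundles using (CommutativeMonoid)
import Algebra.Properties.CommutativeSemigroup as CommutativeSemigroup
open import Data.Bool using (Bool; T; true; false)
open import Data.Bool.Properties using (T?)
open import Data.Integer as ℤ using (ℤ; +_; 0ℤ)
import Data.Integer.Properties as ℤₚ
import Data.Integer.Tactic.RingSolver as ℤ-Solver
open import Data.List using (List; []; _∷_; _∷ʳ_; map; _++_; applyUpTo; upTo; length; filter; filterᵇ; reverse)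
open import Data.List.Properties
  using (map-applyUpTo; map-++; map-∘; map-cong; filter-accept; filter-none; unfold-reverse)
open import Data.List.Relation.Binary.Permutation.Propositional as ↭ using (_↭_; ↭-sym)
open import Data.List.Relation.Binary.Permutation.Propositional.Properties using (All-resp-↭)
open import Data.List.Relation.Unary.All as All using (All; []; _∷_)
import Data.List.Relation.Unary.All.Properties as All
open import Data.List.Relation.Unary.Linked as Linked using (Linked; []; [-]; _∷_)
open import Data.List.Relation.Unary.Linked.Properties using (Linked⇒All)
import Data.List.Sort as Sort
open import Data.Nat as ℕ using (ℕ; zero; suc; _∸_; _≤_; _<_; _≥_; _≤ᵇ_; _<ᵇ_; z≤n; s≤s; _!; _%_)
open import Data.Nat.DivMod using (m≡m%n+[m/n]*n; m%n<n)
open import Data.Nat.Induction using (<-rec)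
open import Data.Nat.ListAction using (product)
open import Data.Nat.ListAction.Properties using (product-++; sum-↭)
import Data.Nat.Properties as ℕₚ
import Data.Nat.Tactic.RingSolver as ℕ-Solver
open import Data.Product using (Σ; _×_; _,_; proj₁; proj₂)
open import Data.Rational using (ℚ; 0ℚ; 1ℚ; _*_; _-_; -_; _/_; toℚᵘ)
import Data.Rational.Properties as ℚₚ
open import Data.Rational.Unnormalised using (mkℚᵘ; *≡*; _≃_)
import Data.Rational.Unnormalised.Properties as ℚᵘₚ
open import Function using (_∘_; flip; id)
open import Level using (0ℓ)
import Relation.Binary.Construct.Flip.EqAndOrd as Flip
open import Relation.Binary.PropositionalEquality
open import Relation.Nullary using (¬_; contradiction)
open import Relation.Nullary.Decidable using (dec⇒maybe)
open import Relation.Nullary.Reflects using (ofⁿ)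
open import Tactic.RingSolver using (solve-∀)
open import Tactic.RingSolver.Core.AlmostCommutativeRing using (AlmostCommutativeRing; fromCommutativeRing)

-- No residue is computed. Peeling off the first row relates the moments of `a ∷ r` to those of `r`
-- by a first-order recurrence: up to a constant, the generating functions differ by one factor (1 -
-- (α - 1) z) / (1 - α z), and such a factor contributes α^j - (α - 1)^j to the power sums. This is
-- why sums run over rows rather than corners: every row yields a factor of the same shape, whether
-- or not neighbouring rows are equal.
--
-- The recurrence does not fix the constant. That is the moment of order 0: the weights of all λ⁺
-- add up to the weight of λ, in other words `D` kills 1 / H. It has its own induction, in which a
-- partial fraction replaces a product of two weights by a linear combination.
--
-- The b_δ must not depend on λ, so the moment polynomials are built for arbitrary sequences
-- satisfying Newton's identities and only afterwards evaluated at a partition.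

module _ where

  open import Data.Rational using (_+_)
  open import Data.Rational.Properties using
    (+-*-commutativeRing; _≟_; +-identityˡ; +-identityʳ; *-identityˡ; *-identityʳ;
    *-zeroˡ; *-zeroʳ; *-comm; *-assoc; +-comm; +-assoc)
  open CommutativeSemigroup ℕₚ.+-commutativeSemigroup using () renaming (interchange to ℕ+-interchange)
  open CommutativeSemigroup (CommutativeMonoid.commutativeSemigroup ℚₚ.+-0-commutativeMonoid)
    using () renaming (interchange to +-interchange)
  open CommutativeSemigroup (CommutativeMonoid.commutativeSemigroup ℚₚ.*-1-commutativeMonoid)
    using () renaming (interchange to *-interchange)
  open ≡-Reasoning

  -- Integers, naturals and inverse factorials as rationals

  ℚ-ring : AlmostCommutativeRing 0ℓ 0ℓ
  ℚ-ring = fromCommutativeRing +-*-commutativeRing (λ x → dec⇒maybe (0ℚ ≟ x))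

  fromℤ : ℤ → ℚ
  fromℤ z = z / 1

  toℚᵘ-/ : ∀ z n → toℚᵘ (z / suc n) ≃ mkℚᵘ z n
  toℚᵘ-/ z n = ℚₚ.toℚᵘ-fromℚᵘ (mkℚᵘ z n)

  fromℤ-+ : ∀ y z → fromℤ (y ℤ.+ z) ≡ fromℤ y + fromℤ z
  fromℤ-+ y z = ℚₚ.toℚᵘ-injective (ℚᵘₚ.≃-trans (toℚᵘ-/ (y ℤ.+ z) 0) (ℚᵘₚ.≃-sym
    (ℚᵘₚ.≃-trans (ℚₚ.toℚᵘ-homo-+ (fromℤ y) (fromℤ z))
    (ℚᵘₚ.≃-trans (ℚᵘₚ.+-cong (toℚᵘ-/ y 0) (toℚᵘ-/ z 0))
      (*≡* (cong (ℤ._* + 1) (cong₂ ℤ._+_ (ℤₚ.*-identityʳ y) (ℤₚ.*-identityʳ z))))))))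

  fromℤ-* : ∀ y z → fromℤ (y ℤ.* z) ≡ fromℤ y * fromℤ z
  fromℤ-* y z = ℚₚ.toℚᵘ-injective (ℚᵘₚ.≃-trans (toℚᵘ-/ (y ℤ.* z) 0) (ℚᵘₚ.≃-sym
    (ℚᵘₚ.≃-trans (ℚₚ.toℚᵘ-homo-* (fromℤ y) (fromℤ z))
    (ℚᵘₚ.≃-trans (ℚᵘₚ.*-cong (toℚᵘ-/ y 0) (toℚᵘ-/ z 0)) (*≡* refl)))))

  fromℤ-neg : ∀ z → fromℤ (ℤ.- z) ≡ - fromℤ z
  fromℤ-neg z = ℚₚ.toℚᵘ-injective (ℚᵘₚ.≃-trans (toℚᵘ-/ (ℤ.- z) 0) (ℚᵘₚ.≃-sym
    (ℚᵘₚ.≃-trans (ℚₚ.toℚᵘ-homo‿- (fromℤ z))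
    (ℚᵘₚ.-‿cong (toℚᵘ-/ z 0)))))

  /-* : ∀ z n .{{_ : ℕ.NonZero n}} → (z / n) * fromℤ (+ n) ≡ fromℤ z
  /-* z (suc n) = ℚₚ.toℚᵘ-injective (ℚᵘₚ.≃-trans
    (ℚᵘₚ.≃-trans (ℚₚ.toℚᵘ-homo-* (z / suc n) (fromℤ (+ suc n)))
      (ℚᵘₚ.≃-trans (ℚᵘₚ.*-cong (toℚᵘ-/ z n) (toℚᵘ-/ (+ suc n) 0))
        (*≡* (trans (ℤₚ.*-identityʳ _) (cong (λ m → z ℤ.* + suc m) (sym (ℕₚ.*-identityʳ n)))))))
    (ℚᵘₚ.≃-sym (toℚᵘ-/ z 0)))

  -- Recursive, so that `ι (suc n)` unfolds to `ι n + 1ℚ` and ring identities apply to successors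
  -- directly.
  ι : ℕ → ℚ
  ι zero    = 0ℚ
  ι (suc n) = ι n + 1ℚ

  ι-fromℤ : ∀ n → fromℤ (+ n) ≡ ι n
  ι-fromℤ zero    = refl
  ι-fromℤ (suc n) = begin
    fromℤ (+ suc n)        ≡⟨ cong (λ m → fromℤ (+ m)) (ℕₚ.+-comm 1 n) ⟩
    fromℤ (+ n ℤ.+ + 1)    ≡⟨ fromℤ-+ (+ n) (+ 1) ⟩
    fromℤ (+ n) + 1ℚ       ≡⟨ cong (_+ 1ℚ) (ι-fromℤ n) ⟩
    ι n + 1ℚ               ∎

  1/suc : ℕ → ℚ
  1/suc n = + 1 / suc n

  ι-inverse : ∀ n → (ι n + 1ℚ) * 1/suc n ≡ 1ℚ
  ι-inverse n = begin
    (ι n + 1ℚ) * 1/suc n       ≡⟨ *-comm (ι n + 1ℚ) (1/suc n) ⟩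
    1/suc n * ι (suc n)        ≡⟨ cong (1/suc n *_) (sym (ι-fromℤ (suc n))) ⟩
    1/suc n * fromℤ (+ suc n)  ≡⟨ /-* (+ 1) (suc n) ⟩
    1ℚ ∎

  1/! : ℕ → ℚ
  1/! zero    = 1ℚ
  1/! (suc n) = 1/! n * 1/suc n

  1/!-suc : ∀ n → (ι n + 1ℚ) * 1/! (suc n) ≡ 1/! n
  1/!-suc n = begin
    (ι n + 1ℚ) * (1/! n * 1/suc n)  ≡⟨ assoc (ι n + 1ℚ) (1/! n) (1/suc n) ⟩
    1/! n * ((ι n + 1ℚ) * 1/suc n)  ≡⟨ cong (1/! n *_) (ι-inverse n) ⟩
    1/! n * 1ℚ                      ≡⟨ *-identityʳ (1/! n) ⟩
    1/! n ∎
    where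
    assoc : ∀ x y z → x * (y * z) ≡ y * (x * z)
    assoc = solve-∀ ℚ-ring

  -- Weights of added boxes

  -- With ℓ = z + length r and ℓ_j = r_j + length r - j, this is Π_j (ℓ - ℓ_j) / ℓ!,
  -- the reciprocal of the product of the hooks in a row of length z on top of r.
  -- The junk value at z < r_1 matters: it is 0 when r_1 = z + 1.
  ρ : ℕ → List ℕ → ℚ
  ρ z []      = 1/! z
  ρ z (a ∷ r) = (ι z - ι a + 1ℚ) * ρ (suc z) r

  h : List ℕ → ℚ
  h []      = 1ℚ
  h (a ∷ r) = ρ a r * h r

  -- A box of content x is added at the end of any row, even where the result is
  -- not a partition: there h vanishes, so that sums weighted by h may run over all rows.
  data Add : List ℕ → List ℕ → ℚ → Set where
    new   : Add [] (1 ∷ []) 0ℚ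
    here  : ∀ {a r} → Add (a ∷ r) (suc a ∷ r) (ι a)
    there : ∀ {a r μ x} → Add r μ x → Add (a ∷ r) (a ∷ μ) (x - 1ℚ)

  Σ⁺ : (List ℕ → ℚ → ℚ) → List ℕ → ℚ
  Σ⁺ g []      = g (1 ∷ []) 0ℚ
  Σ⁺ g (a ∷ r) = g (suc a ∷ r) (ι a) + Σ⁺ (λ μ x → g (a ∷ μ) (x - 1ℚ)) r

  Σ⁺-cong : ∀ {f g} λs → (∀ {μ x} → Add λs μ x → f μ x ≡ g μ x) → Σ⁺ f λs ≡ Σ⁺ g λs
  Σ⁺-cong []      eq = eq new
  Σ⁺-cong (a ∷ r) eq = cong₂ _+_ (eq here) (Σ⁺-cong r (λ s → eq (there s)))

  Σ⁺-+ : ∀ f g λs → Σ⁺ (λ μ x → f μ x + g μ x) λs ≡ Σ⁺ f λs + Σ⁺ g λs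
  Σ⁺-+ f g []      = refl
  Σ⁺-+ f g (a ∷ r) = trans
    (cong (λ y → f (suc a ∷ r) (ι a) + g (suc a ∷ r) (ι a) + y) (Σ⁺-+ _ _ r))
    (+-interchange (f (suc a ∷ r) (ι a)) (g (suc a ∷ r) (ι a)) _ _)

  Σ⁺-* : ∀ c f λs → Σ⁺ (λ μ x → c * f μ x) λs ≡ c * Σ⁺ f λs
  Σ⁺-* c f []      = refl
  Σ⁺-* c f (a ∷ r) = trans
    (cong (λ y → c * f (suc a ∷ r) (ι a) + y) (Σ⁺-* c _ r))
    (sym (ℚₚ.*-distribˡ-+ c (f (suc a ∷ r) (ι a)) _))

  -- Only the factor of the grown row changes, from z - x + 1 to z - x; for a new row, 1 / z! is
  -- read as (z + 1) / (z + 1)!. The form is free of division because z - x + 1 can vanish.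
  ρ-add : ∀ {λs μ x} → Add λs μ x → ∀ z → ρ z μ * (ι z - x + 1ℚ) ≡ ρ z λs * (ι z - x)
  ρ-add new z = trans (ring (ι z) (1/! (suc z))) (cong (_* (ι z - 0ℚ)) (1/!-suc z))
    where
    ring : ∀ z i → (z - (0ℚ + 1ℚ) + 1ℚ) * i * (z - 0ℚ + 1ℚ) ≡ (z + 1ℚ) * i * (z - 0ℚ)
    ring = solve-∀ ℚ-ring
  ρ-add (here {a} {r}) z = ring (ι z) (ι a) (ρ (suc z) r)
    where
    ring : ∀ z a i → (z - (a + 1ℚ) + 1ℚ) * i * (z - a + 1ℚ) ≡ (z - a + 1ℚ) * i * (z - a)
    ring = solve-∀ ℚ-ring
  ρ-add (there {a} {r} {μ} {x} s) z = begin
    (ι z - ι a + 1ℚ) * ρ (suc z) μ * (ι z - (x - 1ℚ) + 1ℚ)  ≡⟨ ring₁ (ι z) (ι a) x (ρ (suc z) μ) ⟩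
    (ι z - ι a + 1ℚ) * (ρ (suc z) μ * (ι (suc z) - x + 1ℚ))  ≡⟨ cong ((ι z - ι a + 1ℚ) *_) (ρ-add s (suc z)) ⟩
    (ι z - ι a + 1ℚ) * (ρ (suc z) r * (ι (suc z) - x))       ≡⟨ ring₂ (ι z) (ι a) x (ρ (suc z) r) ⟩
    (ι z - ι a + 1ℚ) * ρ (suc z) r * (ι z - (x - 1ℚ))        ∎
    where
    ring₁ : ∀ z a x i → (z - a + 1ℚ) * i * (z - (x - 1ℚ) + 1ℚ) ≡ (z - a + 1ℚ) * (i * (z + 1ℚ - x + 1ℚ))
    ring₁ = solve-∀ ℚ-ring
    ring₂ : ∀ z a x i → (z - a + 1ℚ) * (i * (z + 1ℚ - x)) ≡ (z - a + 1ℚ) * i * (z - (x - 1ℚ))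
    ring₂ = solve-∀ ℚ-ring

  -- In terms of u = 1 / (s - x + 1) and v = 1 / (t - x + 1), with ρ s μ = ρ s λ * (1 - u)
  -- and ρ t μ = ρ t λ * (1 - v), this is the partial fraction (t - s) * u * v = u - v.
  ρ-add² : ∀ {λs μ x} → Add λs μ x → ∀ s t →
    (ι t - ι s) * (ρ s μ * ρ t μ) ≡
    (ι t - ι s) * (ρ s μ * ρ t λs + ρ s λs * ρ t μ - ρ s λs * ρ t λs) + ρ s λs * ρ t μ - ρ s μ * ρ t λs
  ρ-add² new s t = subst₂
    (λ i j → (ι t - ι s) * (ρ s (1 ∷ []) * ρ t (1 ∷ [])) ≡
      (ι t - ι s) * (ρ s (1 ∷ []) * j + i * ρ t (1 ∷ []) - i * j) + i * ρ t (1 ∷ []) - ρ s (1 ∷ []) * j)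
    (1/!-suc s) (1/!-suc t) (ring (ι s) (ι t) (1/! (suc s)) (1/! (suc t)))
    where
    ring : ∀ s t i j →
      (t - s) * ((s - (0ℚ + 1ℚ) + 1ℚ) * i * ((t - (0ℚ + 1ℚ) + 1ℚ) * j)) ≡
      (t - s) * ((s - (0ℚ + 1ℚ) + 1ℚ) * i * ((t + 1ℚ) * j) + (s + 1ℚ) * i * ((t - (0ℚ + 1ℚ) + 1ℚ) * j)
        - (s + 1ℚ) * i * ((t + 1ℚ) * j))
      + (s + 1ℚ) * i * ((t - (0ℚ + 1ℚ) + 1ℚ) * j) - (s - (0ℚ + 1ℚ) + 1ℚ) * i * ((t + 1ℚ) * j)
    ring = solve-∀ ℚ-ring
  ρ-add² (here {a} {r}) s t = ring (ι s) (ι t) (ι a) (ρ (suc s) r) (ρ (suc t) r)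
    where
    ring : ∀ s t a i j →
      (t - s) * ((s - (a + 1ℚ) + 1ℚ) * i * ((t - (a + 1ℚ) + 1ℚ) * j)) ≡
      (t - s) * ((s - (a + 1ℚ) + 1ℚ) * i * ((t - a + 1ℚ) * j) + (s - a + 1ℚ) * i * ((t - (a + 1ℚ) + 1ℚ) * j)
        - (s - a + 1ℚ) * i * ((t - a + 1ℚ) * j))
      + (s - a + 1ℚ) * i * ((t - (a + 1ℚ) + 1ℚ) * j) - (s - (a + 1ℚ) + 1ℚ) * i * ((t - a + 1ℚ) * j)
    ring = solve-∀ ℚ-ring
  ρ-add² (there {a} {r} {μ} p) s t = trans
    (ring₁ (ι s) (ι t) (ι a) (ρ (suc s) μ) (ρ (suc t) μ))
    (trans (cong ((ι s - ι a + 1ℚ) * (ι t - ι a + 1ℚ) *_) (ρ-add² p (suc s) (suc t)))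
      (ring₂ (ι s) (ι t) (ι a) (ρ (suc s) μ) (ρ (suc t) μ) (ρ (suc s) r) (ρ (suc t) r)))
    where
    ring₁ : ∀ s t a i j → (t - s) * ((s - a + 1ℚ) * i * ((t - a + 1ℚ) * j)) ≡
      (s - a + 1ℚ) * (t - a + 1ℚ) * ((t + 1ℚ - (s + 1ℚ)) * (i * j))
    ring₁ = solve-∀ ℚ-ring
    ring₂ : ∀ s t a i j k l →
      (s - a + 1ℚ) * (t - a + 1ℚ) * ((t + 1ℚ - (s + 1ℚ)) * (i * l + k * j - k * l) + k * j - i * l) ≡
      (t - s) * ((s - a + 1ℚ) * i * ((t - a + 1ℚ) * l) + (s - a + 1ℚ) * k * ((t - a + 1ℚ) * j)
        - (s - a + 1ℚ) * k * ((t - a + 1ℚ) * l))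
      + (s - a + 1ℚ) * k * ((t - a + 1ℚ) * j) - (s - a + 1ℚ) * i * ((t - a + 1ℚ) * l)
    ring₂ = solve-∀ ℚ-ring

  -- The second identity for a ∷ r is the first one for r at z = a; it is the first one,
  -- with its free parameter z, that goes through by induction.
  Σ⁺-h-ρ : ∀ λs z → Σ⁺ (λ μ _ → h μ * ρ z μ) λs ≡ h λs * (ρ z λs - ρ (suc z) λs)
  Σ⁺-h : ∀ λs → Σ⁺ (λ μ _ → h μ) λs ≡ h λs

  Σ⁺-h []      = refl
  Σ⁺-h (a ∷ r) = begin
    ρ (suc a) r * h r + Σ⁺ (λ μ _ → ρ a μ * h μ) r
      ≡⟨ cong (λ y → ρ (suc a) r * h r + y) (Σ⁺-cong r (λ {μ} _ → *-comm (ρ a μ) (h μ))) ⟩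
    ρ (suc a) r * h r + Σ⁺ (λ μ _ → h μ * ρ a μ) r
      ≡⟨ cong (λ y → ρ (suc a) r * h r + y) (Σ⁺-h-ρ r a) ⟩
    ρ (suc a) r * h r + h r * (ρ a r - ρ (suc a) r)
      ≡⟨ ring (ρ (suc a) r) (h r) (ρ a r) ⟩
    ρ a r * h r ∎
    where
    ring : ∀ x y z → x * y + y * (z - x) ≡ z * y
    ring = solve-∀ ℚ-ring

  Σ⁺-h-ρ [] z = subst (λ i → 1ℚ * 1ℚ * ((ι z - 1ℚ + 1ℚ) * 1/! (suc z)) ≡ 1ℚ * (i - 1/! (suc z)))
    (1/!-suc z) (ring (ι z) (1/! (suc z)))
    where
    ring : ∀ z i → 1ℚ * 1ℚ * ((z - 1ℚ + 1ℚ) * i) ≡ 1ℚ * ((z + 1ℚ) * i - i)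
    ring = solve-∀ ℚ-ring
  Σ⁺-h-ρ (a ∷ r) z = begin
    ρ (suc a) r * h r * ((ι z - (ι a + 1ℚ) + 1ℚ) * B) + Σ⁺ (λ μ _ → ρ a μ * h μ * ((ι z - ι a + 1ℚ) * ρ (suc z) μ)) r
      ≡⟨ cong (λ y → ρ (suc a) r * h r * ((ι z - (ι a + 1ℚ) + 1ℚ) * B) + y) sum ⟩
    ρ (suc a) r * h r * ((ι z - (ι a + 1ℚ) + 1ℚ) * B)
      + (c₁ * (h r * (A - ρ (suc a) r)) + c₂ * (h r * (B - ρ (suc (suc z)) r)) + c₃ * h r)
      ≡⟨ ring₂ (ι z) (ι a) A B (h r) (ρ (suc a) r) (ρ (suc (suc z)) r) ⟩
    A * h r * ((ι z - ι a + 1ℚ) * B - (ι z + 1ℚ - ι a + 1ℚ) * ρ (suc (suc z)) r) ∎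
    where
    A = ρ a r
    B = ρ (suc z) r
    w = ι z + 1ℚ - ι a
    c₁ = w * B - B
    c₂ = w * A + A
    c₃ = - (w * (A * B))
    ring₀ : ∀ z a i j k → i * k * ((z - a + 1ℚ) * j) ≡ k * ((z + 1ℚ - a) * (i * j))
    ring₀ = solve-∀ ℚ-ring
    ring₁ : ∀ w A B i j k → k * (w * (i * B + A * j - A * B) + A * j - i * B) ≡
      (w * B - B) * (k * i) + (w * A + A) * (k * j) + - (w * (A * B)) * k
    ring₁ = solve-∀ ℚ-ring
    ring₂ : ∀ z a A B k A⁺ B⁺ →
      A⁺ * k * ((z - (a + 1ℚ) + 1ℚ) * B) + (((z + 1ℚ - a) * B - B) * (k * (A - A⁺))
        + ((z + 1ℚ - a) * A + A) * (k * (B - B⁺)) + - ((z + 1ℚ - a) * (A * B)) * k) ≡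
      A * k * ((z - a + 1ℚ) * B - (z + 1ℚ - a + 1ℚ) * B⁺)
    ring₂ = solve-∀ ℚ-ring
    sum : Σ⁺ (λ μ _ → ρ a μ * h μ * ((ι z - ι a + 1ℚ) * ρ (suc z) μ)) r ≡
      c₁ * (h r * (A - ρ (suc a) r)) + c₂ * (h r * (B - ρ (suc (suc z)) r)) + c₃ * h r
    sum = begin
      Σ⁺ (λ μ _ → ρ a μ * h μ * ((ι z - ι a + 1ℚ) * ρ (suc z) μ)) r
        -- The factor z - a + 1 of the top row is the t - s of `ρ-add²` for s = a and t = z + 1. It
        -- makes the product of two weights linear in them, with coefficients that do not involve
        -- the added box.
        ≡⟨ Σ⁺-cong r (λ {μ} s → trans (ring₀ (ι z) (ι a) (ρ a μ) (ρ (suc z) μ) (h μ))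
             (trans (cong (h μ *_) (ρ-add² s a (suc z))) (ring₁ w A B (ρ a μ) (ρ (suc z) μ) (h μ)))) ⟩
      Σ⁺ (λ μ _ → c₁ * (h μ * ρ a μ) + c₂ * (h μ * ρ (suc z) μ) + c₃ * h μ) r
        ≡⟨ trans (Σ⁺-+ _ _ r) (cong₂ _+_
             (trans (Σ⁺-+ _ _ r) (cong₂ _+_ (Σ⁺-* c₁ _ r) (Σ⁺-* c₂ _ r))) (Σ⁺-* c₃ _ r)) ⟩
      c₁ * Σ⁺ (λ μ _ → h μ * ρ a μ) r + c₂ * Σ⁺ (λ μ _ → h μ * ρ (suc z) μ) r + c₃ * Σ⁺ (λ μ _ → h μ) r
        ≡⟨ cong₂ _+_ (cong₂ _+_ (cong (c₁ *_) (Σ⁺-h-ρ r a)) (cong (c₂ *_) (Σ⁺-h-ρ r (suc z)))) (cong (c₃ *_) (Σ⁺-h r)) ⟩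
      c₁ * (h r * (A - ρ (suc a) r)) + c₂ * (h r * (B - ρ (suc (suc z)) r)) + c₃ * h r ∎
  -- Convolutions and Newton's identities


  infixr 8 _^_
  _^_ : ℚ → ℕ → ℚ
  x ^ zero  = 1ℚ
  x ^ suc k = x * x ^ k

  conv : (ℕ → ℚ) → (ℕ → ℚ) → ℕ → ℚ
  conv f g zero    = f 0 * g 0
  conv f g (suc k) = f 0 * g (suc k) + conv (f ∘ suc) g k

  conv-congʳ : ∀ f {g g′} → (∀ j → g j ≡ g′ j) → ∀ k → conv f g k ≡ conv f g′ k
  conv-congʳ f eq zero    = cong (f 0 *_) (eq 0)
  conv-congʳ f eq (suc k) = cong₂ _+_ (cong (f 0 *_) (eq (suc k))) (conv-congʳ (f ∘ suc) eq k)

  conv-*ˡ : ∀ c f g k → conv (λ j → c * f j) g k ≡ c * conv f g k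
  conv-*ˡ c f g zero    = *-assoc c (f 0) (g 0)
  conv-*ˡ c f g (suc k) = trans (cong₂ _+_ (*-assoc c (f 0) (g (suc k))) (conv-*ˡ c (f ∘ suc) g k))
    (sym (ℚₚ.*-distribˡ-+ c (f 0 * g (suc k)) _))

  conv-*ʳ : ∀ c f g k → conv f (λ j → c * g j) k ≡ c * conv f g k
  conv-*ʳ c f g zero    = ring c (f 0) (g 0)
    where
    ring : ∀ c x y → x * (c * y) ≡ c * (x * y)
    ring = solve-∀ ℚ-ring
  conv-*ʳ c f g (suc k) = trans (cong (λ y → f 0 * (c * g (suc k)) + y) (conv-*ʳ c (f ∘ suc) g k))
    (ring c (f 0) (g (suc k)) _)
    where
    ring : ∀ c x y z → x * (c * y) + c * z ≡ c * (x * y + z)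
    ring = solve-∀ ℚ-ring

  conv-−ʳ : ∀ c f g g′ k → conv f (λ j → g j - c * g′ j) k ≡ conv f g k - c * conv f g′ k
  conv-−ʳ c f g g′ zero    = ring c (f 0) (g 0) (g′ 0)
    where
    ring : ∀ c x y z → x * (y - c * z) ≡ x * y - c * (x * z)
    ring = solve-∀ ℚ-ring
  conv-−ʳ c f g g′ (suc k) = trans (cong (λ y → f 0 * (g (suc k) - c * g′ (suc k)) + y) (conv-−ʳ c (f ∘ suc) g g′ k))
    (ring c (f 0) (g (suc k)) (g′ (suc k)) _ _)
    where
    ring : ∀ c x y z v w → x * (y - c * z) + (v - c * w) ≡ x * y + v - c * (x * z + w)
    ring = solve-∀ ℚ-ring

  conv-−+ˡ : ∀ f₁ f₂ f₃ g k → conv (λ j → f₁ j - f₂ j + f₃ j) g k ≡ conv f₁ g k - conv f₂ g k + conv f₃ g k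
  conv-−+ˡ f₁ f₂ f₃ g zero    = ring (f₁ 0) (f₂ 0) (f₃ 0) (g 0)
    where
    ring : ∀ a b c x → (a - b + c) * x ≡ a * x - b * x + c * x
    ring = solve-∀ ℚ-ring
  conv-−+ˡ f₁ f₂ f₃ g (suc k) =
    trans (cong (λ y → (f₁ 0 - f₂ 0 + f₃ 0) * g (suc k) + y) (conv-−+ˡ (f₁ ∘ suc) (f₂ ∘ suc) (f₃ ∘ suc) g k))
      (ring (f₁ 0) (f₂ 0) (f₃ 0) (g (suc k)) _ _ _)
    where
    ring : ∀ a b c x u v w → (a - b + c) * x + (u - v + w) ≡ a * x + u - (b * x + v) + (c * x + w)
    ring = solve-∀ ℚ-ring

  conv-shift : ∀ f g k → conv f g (suc k) ≡ conv f (g ∘ suc) k + f (suc k) * g 0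
  conv-shift f g zero    = refl
  conv-shift f g (suc k) = trans (cong (λ y → f 0 * g (suc (suc k)) + y) (conv-shift (f ∘ suc) g k))
    (sym (+-assoc (f 0 * g (suc (suc k))) _ _))

  powers : ℚ → ℕ → ℚ
  powers x j = x ^ suc j

  conv-powers : ∀ x g k → conv (powers x) g (suc k) ≡ x * g (suc k) + x * conv (powers x) g k
  conv-powers x g k = cong₂ _+_ (cong (_* g (suc k)) (*-identityʳ x)) (conv-*ˡ x (powers x) g k)

  -- Multiplies the generating function of `g` by 1 - c z. The shifted sequence omits the constant
  -- coefficient `g 0`, which returns as the boundary term.
  conv-difference : ∀ c f g k →
    conv f (λ j → g (suc j) - c * g j) k + f (suc k) * g 0 ≡ conv f g (suc k) - c * conv f g k
  conv-difference c f g k = begin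
    conv f (λ j → g (suc j) - c * g j) k + f (suc k) * g 0
      ≡⟨ cong (_+ f (suc k) * g 0) (conv-−ʳ c f (g ∘ suc) g k) ⟩
    conv f (g ∘ suc) k - c * conv f g k + f (suc k) * g 0
      ≡⟨ ring (conv f (g ∘ suc) k) (c * conv f g k) (f (suc k) * g 0) ⟩
    conv f (g ∘ suc) k + f (suc k) * g 0 - c * conv f g k
      ≡⟨ cong (_- c * conv f g k) (sym (conv-shift f g k)) ⟩
    conv f g (suc k) - c * conv f g k ∎
    where
    ring : ∀ x y z → x - y + z ≡ x + z - y
    ring = solve-∀ ℚ-ring

  -- Newton's identities, with p j standing for the power sum of degree j + 1.
  Newton : (p M : ℕ → ℚ) → Set
  Newton p M = ∀ k → ι (suc k) * M (suc k) ≡ conv p M k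

  -- In generating functions: (1 - α z) M(z) = (1 - β z) N(z).
  newton-step : ∀ α β n M N → M 0 ≡ N 0 → (∀ k → M (suc k) ≡ α * M k + (N (suc k) - β * N k)) →
    Newton n N → Newton (λ j → powers α j - powers β j + n j) M
  newton-step α β n M N M₀ rec nN zero = begin
    ι 1 * M 1                                       ≡⟨ cong (ι 1 *_) (rec 0) ⟩
    ι 1 * (α * M 0 + (N 1 - β * N 0))               ≡⟨ ring₁ α β (M 0) (N 0) (N 1) ⟩
    α * M 0 + (ι 1 * N 1 - β * N 0)                 ≡⟨ cong (λ y → α * M 0 + (y - β * N 0)) (nN 0) ⟩
    α * M 0 + (n 0 * N 0 - β * N 0)                 ≡⟨ cong (λ y → α * M 0 + (n 0 * y - β * y)) (sym M₀) ⟩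
    α * M 0 + (n 0 * M 0 - β * M 0)                 ≡⟨ ring₂ α β (n 0) (M 0) ⟩
    (α * 1ℚ - β * 1ℚ + n 0) * M 0                   ∎
    where
    ring₁ : ∀ α β m l k → (0ℚ + 1ℚ) * (α * m + (k - β * l)) ≡ α * m + ((0ℚ + 1ℚ) * k - β * l)
    ring₁ = solve-∀ ℚ-ring
    ring₂ : ∀ α β n m → α * m + (n * m - β * m) ≡ (α * 1ℚ - β * 1ℚ + n) * m
    ring₂ = solve-∀ ℚ-ring
  newton-step α β n M N M₀ rec nN (suc k) = sym (begin
    conv p M (suc k)
      ≡⟨ ring₁ (conv p M (suc k)) (α * conv p M k) ⟩
    conv p M (suc k) - α * conv p M k + α * conv p M k
      ≡⟨ cong₂ (λ y z → y + α * z) (sym (conv-difference α p M k)) (sym (newton-step α β n M N M₀ rec nN k)) ⟩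
    conv p U k + p (suc k) * M 0 + α * (ι (suc k) * M (suc k))
      ≡⟨ cong (λ y → y + p (suc k) * M 0 + α * (ι (suc k) * M (suc k))) (conv-−+ˡ (powers α) (powers β) n U k) ⟩
    conv (powers α) U k - conv (powers β) U k + conv n U k + p (suc k) * M 0 + α * (ι (suc k) * M (suc k))
      ≡⟨ ring₂ (conv (powers α) U k) (conv (powers β) U k) (conv n U k) (powers α (suc k)) (powers β (suc k))
           (n (suc k)) (M 0) _ ⟩
    (conv (powers α) U k + powers α (suc k) * M 0) - (conv (powers β) U k + powers β (suc k) * M 0)
      + (conv n U k + n (suc k) * M 0) + α * (ι (suc k) * M (suc k))
      ≡⟨ cong (λ y → y + α * (ι (suc k) * M (suc k))) (cong₂ _+_ (cong₂ _-_ eα eβ) en) ⟩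
    α * M (suc k) - β * N (suc k) + (ι (suc (suc k)) * N (suc (suc k)) - β * (ι (suc k) * N (suc k)))
      + α * (ι (suc k) * M (suc k))
      ≡⟨ ring₃ α β (ι (suc k)) (M (suc k)) (N (suc k)) (N (suc (suc k))) ⟩
    ι (suc (suc k)) * (α * M (suc k) + (N (suc (suc k)) - β * N (suc k)))
      ≡⟨ cong (ι (suc (suc k)) *_) (sym (rec (suc k))) ⟩
    ι (suc (suc k)) * M (suc (suc k)) ∎)
    where
    -- `U` and `U′` are the coefficients, past the constant one, of (1 - α z) M(z) and (1 - β z)
    -- N(z). As they agree, each part of `p` may use the convenient one: the powers of α use `U`,
    -- the other two parts `U′`.
    p U U′ : ℕ → ℚ
    p j = powers α j - powers β j + n j
    U j = M (suc j) - α * M j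
    U′ j = N (suc j) - β * N j
    ring₀ : ∀ a b → a + b - a ≡ b
    ring₀ = solve-∀ ℚ-ring
    U≡U′ : ∀ j → U j ≡ U′ j
    U≡U′ j = trans (cong (_- α * M j) (rec j)) (ring₀ (α * M j) (U′ j))
    conv-N : ∀ f → conv f U k + f (suc k) * M 0 ≡ conv f N (suc k) - β * conv f N k
    conv-N f = trans (cong₂ (λ y z → y + f (suc k) * z) (conv-congʳ f U≡U′ k) M₀) (conv-difference β f N k)
    ring₄ : ∀ x y → x + y - y ≡ x
    ring₄ = solve-∀ ℚ-ring
    -- The sequence `powers x` has generating function x / (1 - x z), so the factor 1 - x z leaves
    -- only x.
    conv-powers-difference : ∀ x g → conv (powers x) g (suc k) - x * conv (powers x) g k ≡ x * g (suc k)
    conv-powers-difference x g = trans (cong (_- x * conv (powers x) g k) (conv-powers x g k))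
      (ring₄ (x * g (suc k)) (x * conv (powers x) g k))
    eα : conv (powers α) U k + powers α (suc k) * M 0 ≡ α * M (suc k)
    eα = trans (conv-difference α (powers α) M k) (conv-powers-difference α M)
    eβ : conv (powers β) U k + powers β (suc k) * M 0 ≡ β * N (suc k)
    eβ = trans (conv-N (powers β)) (conv-powers-difference β N)
    en : conv n U k + n (suc k) * M 0 ≡ ι (suc (suc k)) * N (suc (suc k)) - β * (ι (suc k) * N (suc k))
    en = trans (conv-N n) (cong₂ (λ y z → y - β * z) (sym (nN (suc k))) (sym (nN k)))
    ring₁ : ∀ x y → x ≡ x - y + y
    ring₁ = solve-∀ ℚ-ring
    ring₂ : ∀ a b c x y z m w → a - b + c + (x - y + z) * m + w ≡ a + x * m - (b + y * m) + (c + z * m) + w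
    ring₂ = solve-∀ ℚ-ring
    ring₃ : ∀ α β i m n n′ → α * m - β * n + ((i + 1ℚ) * n′ - β * (i * n)) + α * (i * m) ≡
      (i + 1ℚ) * (α * m + (n′ - β * n))
    ring₃ = solve-∀ ℚ-ring

  -- Power sums and moments of contents

  -- For c = 0 the sum of the α^k - (α - 1)^k over the contents α of the first box
  -- to the right of each row, closed off by the content of the first box below the
  -- last row; for partitions it telescopes to q_k.  The shift c serves the induction on rows.
  rowPower : ℚ → List ℕ → ℕ → ℚ
  rowPower c []      k = c ^ k
  rowPower c (a ∷ r) k = (ι a + c) ^ k - (ι a + c - 1ℚ) ^ k + rowPower (c - 1ℚ) r k

  Δ : ℕ → ℚ → ℚ
  Δ k x = (x + 1ℚ) ^ k + (x - 1ℚ) ^ k - (x ^ k + x ^ k)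

  -- Lengthening a row moves its pair of contents from (α, α - 1) to (α + 1, α), which changes the
  -- difference of k-th powers by a second difference at α. A new row has the same effect on the
  -- closing term.
  rowPower-add : ∀ {λs μ x} → Add λs μ x → ∀ c k → rowPower c μ k ≡ rowPower c λs k + Δ k (x + c)
  rowPower-add new c k = begin
    (1ℚ + c) ^ k - (1ℚ + c - 1ℚ) ^ k + (c - 1ℚ) ^ k
      ≡⟨ cong₂ (λ y z → y ^ k - z ^ k + (c - 1ℚ) ^ k) (+-comm 1ℚ c) (ring₁ c) ⟩
    (c + 1ℚ) ^ k - c ^ k + (c - 1ℚ) ^ k
      ≡⟨ ring₂ ((c + 1ℚ) ^ k) (c ^ k) ((c - 1ℚ) ^ k) ⟩
    c ^ k + Δ k c
      ≡⟨ cong (λ y → c ^ k + Δ k y) (sym (+-identityˡ c)) ⟩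
    c ^ k + Δ k (0ℚ + c) ∎
    where
    ring₁ : ∀ c → 1ℚ + c - 1ℚ ≡ c
    ring₁ = solve-∀ ℚ-ring
    ring₂ : ∀ u v w → u - v + w ≡ v + (u + w - (v + v))
    ring₂ = solve-∀ ℚ-ring
  rowPower-add (here {a} {r}) c k = begin
    (ι a + 1ℚ + c) ^ k - (ι a + 1ℚ + c - 1ℚ) ^ k + rowPower (c - 1ℚ) r k
      ≡⟨ cong₂ (λ y z → y ^ k - z ^ k + rowPower (c - 1ℚ) r k) (ring₁ (ι a) c) (ring₂ (ι a) c) ⟩
    (ι a + c + 1ℚ) ^ k - (ι a + c) ^ k + rowPower (c - 1ℚ) r k
      ≡⟨ ring₃ ((ι a + c + 1ℚ) ^ k) ((ι a + c) ^ k) ((ι a + c - 1ℚ) ^ k) (rowPower (c - 1ℚ) r k) ⟩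
    (ι a + c) ^ k - (ι a + c - 1ℚ) ^ k + rowPower (c - 1ℚ) r k + Δ k (ι a + c) ∎
    where
    ring₁ : ∀ a c → a + 1ℚ + c ≡ a + c + 1ℚ
    ring₁ = solve-∀ ℚ-ring
    ring₂ : ∀ a c → a + 1ℚ + c - 1ℚ ≡ a + c
    ring₂ = solve-∀ ℚ-ring
    ring₃ : ∀ u v w x → u - v + x ≡ v - w + x + (u + w - (v + v))
    ring₃ = solve-∀ ℚ-ring
  rowPower-add (there {a} {r} {μ} {x} s) c k = begin
    (ι a + c) ^ k - (ι a + c - 1ℚ) ^ k + rowPower (c - 1ℚ) μ k
      ≡⟨ cong (λ y → (ι a + c) ^ k - (ι a + c - 1ℚ) ^ k + y) (rowPower-add s (c - 1ℚ) k) ⟩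
    (ι a + c) ^ k - (ι a + c - 1ℚ) ^ k + (rowPower (c - 1ℚ) r k + Δ k (x + (c - 1ℚ)))
      ≡⟨ sym (+-assoc ((ι a + c) ^ k - (ι a + c - 1ℚ) ^ k) (rowPower (c - 1ℚ) r k) _) ⟩
    (ι a + c) ^ k - (ι a + c - 1ℚ) ^ k + rowPower (c - 1ℚ) r k + Δ k (x + (c - 1ℚ))
      ≡⟨ cong (λ y → (ι a + c) ^ k - (ι a + c - 1ℚ) ^ k + rowPower (c - 1ℚ) r k + Δ k y) (ring x c) ⟩
    (ι a + c) ^ k - (ι a + c - 1ℚ) ^ k + rowPower (c - 1ℚ) r k + Δ k (x - 1ℚ + c) ∎
    where
    ring : ∀ x c → x + (c - 1ℚ) ≡ x - 1ℚ + c
    ring = solve-∀ ℚ-ring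

  moment : ℚ → List ℕ → ℕ → ℚ
  moment c λs k = Σ⁺ (λ μ x → (x + c) ^ k * h μ) λs

  moment-0 : ∀ c λs → moment c λs 0 ≡ h λs
  moment-0 c λs = trans (Σ⁺-cong λs (λ {μ} _ → *-identityˡ (h μ))) (Σ⁺-h λs)

  -- A box in the top row has shifted content α = a + c, so one more power is a factor α. For a box
  -- lower down, the shifted content is α - (a - x + 1), and `ρ-add` trades `ρ a μ` times a - x + 1
  -- for `ρ a r` times a - x, leaving moments of `r` alone. The result has the shape that
  -- `newton-step` requires.
  moment-suc : ∀ c a r k → moment c (a ∷ r) (suc k) ≡
    (ι a + c) * moment c (a ∷ r) k +
    (ρ a r * moment (c - 1ℚ) r (suc k) - (ι a + c - 1ℚ) * (ρ a r * moment (c - 1ℚ) r k))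
  moment-suc c a r k = begin
    α * α ^ k * h₁ + Σ⁺ (λ μ x → (x - 1ℚ + c) * (x - 1ℚ + c) ^ k * (ρ a μ * h μ)) r
      ≡⟨ cong (λ y → α * α ^ k * h₁ + y) (trans (Σ⁺-cong r pointwise)
           (trans (Σ⁺-+ _ _ r) (cong₂ _+_ (Σ⁺-* α _ r)
             (trans (Σ⁺-+ _ _ r) (cong₂ _+_ (Σ⁺-* (ρ a r) _ r) (Σ⁺-* (- ((α - 1ℚ) * ρ a r)) _ r)))))) ⟩
    α * α ^ k * h₁ + (α * S + (ρ a r * moment (c - 1ℚ) r (suc k) + - ((α - 1ℚ) * ρ a r) * moment (c - 1ℚ) r k))
      ≡⟨ ring₀ α (α ^ k) h₁ S (ρ a r) (moment (c - 1ℚ) r (suc k)) (moment (c - 1ℚ) r k) ⟩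
    α * (α ^ k * h₁ + S) + (ρ a r * moment (c - 1ℚ) r (suc k) - (α - 1ℚ) * (ρ a r * moment (c - 1ℚ) r k)) ∎
    where
    α = ι a + c
    h₁ = h (suc a ∷ r)
    S = Σ⁺ (λ μ x → (x - 1ℚ + c) ^ k * (ρ a μ * h μ)) r
    ring₀ : ∀ α αk h S ρ m m′ → α * αk * h + (α * S + (ρ * m + - ((α - 1ℚ) * ρ) * m′)) ≡
      α * (αk * h + S) + (ρ * m - (α - 1ℚ) * (ρ * m′))
    ring₀ = solve-∀ ℚ-ring
    ring₁ : ∀ a x c yk ρ h → (x - 1ℚ + c) * yk * (ρ * h) ≡
      (a + c) * (yk * (ρ * h)) - ρ * (a - x + 1ℚ) * (yk * h)
    ring₁ = solve-∀ ℚ-ring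
    ring₂ : ∀ a x c yk ρ ρ′ h → (a + c) * (yk * (ρ * h)) - ρ′ * (a - x) * (yk * h) ≡
      (a + c) * (yk * (ρ * h)) +
      (ρ′ * ((x + (c - 1ℚ)) * yk * h) + - ((a + c - 1ℚ) * ρ′) * (yk * h))
    ring₂ = solve-∀ ℚ-ring
    ring₃ : ∀ x c → x - 1ℚ + c ≡ x + (c - 1ℚ)
    ring₃ = solve-∀ ℚ-ring
    pointwise : ∀ {μ x} → Add r μ x → (x - 1ℚ + c) * (x - 1ℚ + c) ^ k * (ρ a μ * h μ) ≡
      α * ((x - 1ℚ + c) ^ k * (ρ a μ * h μ)) +
      (ρ a r * ((x + (c - 1ℚ)) * (x + (c - 1ℚ)) ^ k * h μ) + - ((α - 1ℚ) * ρ a r) * ((x + (c - 1ℚ)) ^ k * h μ))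
    pointwise {μ} {x} s = begin
      (x - 1ℚ + c) * (x - 1ℚ + c) ^ k * (ρ a μ * h μ)
        ≡⟨ ring₁ (ι a) x c yk (ρ a μ) (h μ) ⟩
      α * (yk * (ρ a μ * h μ)) - ρ a μ * (ι a - x + 1ℚ) * (yk * h μ)
        ≡⟨ cong (λ y → α * (yk * (ρ a μ * h μ)) - y * (yk * h μ)) (ρ-add s a) ⟩
      α * (yk * (ρ a μ * h μ)) - ρ a r * (ι a - x) * (yk * h μ)
        ≡⟨ ring₂ (ι a) x c yk (ρ a μ) (ρ a r) (h μ) ⟩
      α * (yk * (ρ a μ * h μ)) + (ρ a r * ((x + (c - 1ℚ)) * yk * h μ) + - ((α - 1ℚ) * ρ a r) * (yk * h μ))
        ≡⟨ cong (λ y → α * (yk * (ρ a μ * h μ)) + (ρ a r * ((x + (c - 1ℚ)) * y * h μ) + - ((α - 1ℚ) * ρ a r) * (y * h μ)))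
             (cong (_^ k) (ring₃ x c)) ⟩
      α * (yk * (ρ a μ * h μ)) + (ρ a r * ((x + (c - 1ℚ)) * (x + (c - 1ℚ)) ^ k * h μ)
        + - ((α - 1ℚ) * ρ a r) * ((x + (c - 1ℚ)) ^ k * h μ)) ∎
      where
      yk = (x - 1ℚ + c) ^ k

  newton-powers : ∀ x → Newton (powers x) (x ^_)
  newton-powers x zero    = ring x
    where
    ring : ∀ x → (0ℚ + 1ℚ) * (x * 1ℚ) ≡ x * 1ℚ * 1ℚ
    ring = solve-∀ ℚ-ring
  newton-powers x (suc k) = begin
    (ι (suc k) + 1ℚ) * (x * x ^ suc k)                        ≡⟨ ring (ι (suc k)) x (x ^ suc k) ⟩
    x * x ^ suc k + x * (ι (suc k) * x ^ suc k)               ≡⟨ cong (λ y → x * x ^ suc k + x * y) (newton-powers x k) ⟩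
    x * x ^ suc k + x * conv (powers x) (x ^_) k              ≡⟨ sym (conv-powers x (x ^_) k) ⟩
    conv (powers x) (x ^_) (suc k)                            ∎
    where
    ring : ∀ i x y → (i + 1ℚ) * (x * y) ≡ x * y + x * (i * y)
    ring = solve-∀ ℚ-ring

  newton-* : ∀ c p M → Newton p M → Newton p (λ k → c * M k)
  newton-* c p M nM k = begin
    ι (suc k) * (c * M (suc k))  ≡⟨ ring (ι (suc k)) c (M (suc k)) ⟩
    c * (ι (suc k) * M (suc k))  ≡⟨ cong (c *_) (nM k) ⟩
    c * conv p M k               ≡⟨ sym (conv-*ʳ c p M k) ⟩
    conv p (λ k → c * M k) k     ∎
    where
    ring : ∀ i c m → i * (c * m) ≡ c * (i * m)
    ring = solve-∀ ℚ-ring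

  newton-cong : ∀ p {M M′} → (∀ k → M k ≡ M′ k) → Newton p M → Newton p M′
  newton-cong p eq nM k = trans (cong (ι (suc k) *_) (sym (eq (suc k)))) (trans (nM k) (conv-congʳ p eq k))

  moment-newton : ∀ c λs → Newton (rowPower c λs ∘ suc) (moment c λs)
  moment-newton c []      = newton-cong (powers c)
    (λ k → sym (trans (*-identityʳ ((0ℚ + c) ^ k)) (cong (_^ k) (+-identityˡ c)))) (newton-powers c)
  moment-newton c (a ∷ r) = newton-step (ι a + c) (ι a + c - 1ℚ) (rowPower (c - 1ℚ) r ∘ suc)
    (moment c (a ∷ r)) (λ k → ρ a r * moment (c - 1ℚ) r k)
    (trans (moment-0 c (a ∷ r)) (cong (ρ a r *_) (sym (moment-0 (c - 1ℚ) r))))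
    (moment-suc c a r)
    (newton-* (ρ a r) _ _ (moment-newton (c - 1ℚ) r))
  -- Polynomials in the q_k


  module Graded {E I : Set} (deg : I → ℕ) (ev : I → E → ℚ) where

    -- Linear combinations of monomials of degree at most d - e; none exist if d < e.
    data Span (e d : ℕ) : (E → ℚ) → Set where
      none : ∀ {f} → (∀ ε → f ε ≡ 0ℚ) → Span e d f
      term : ∀ {f} b i → deg i ℕ.+ e ≤ d → (∀ ε → f ε ≡ b * ev i ε) → Span e d f
      plus : ∀ {f g k} → Span e d f → Span e d g → (∀ ε → k ε ≡ f ε + g ε) → Span e d k

    span-+ : ∀ {e d f g} → Span e d f → Span e d g → Span e d (λ ε → f ε + g ε)
    span-+ u v = plus u v (λ ε → refl)

    span-* : ∀ {e d f} c → Span e d f → Span e d (λ ε → c * f ε)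
    span-* c (none z)       = none (λ ε → trans (cong (c *_) (z ε)) (*-zeroʳ c))
    span-* c (term b i l t) = term (c * b) i l (λ ε → trans (cong (c *_) (t ε)) (sym (*-assoc c b _)))
    span-* c (plus u v t)   = plus (span-* c u) (span-* c v)
      (λ ε → trans (cong (c *_) (t ε)) (ℚₚ.*-distribˡ-+ c _ _))

    span-weaken : ∀ {e e′ d d′ f} → (∀ n → n ℕ.+ e ≤ d → n ℕ.+ e′ ≤ d′) → Span e d f → Span e′ d′ f
    span-weaken w (none z)       = none z
    span-weaken w (term b i l t) = term b i (w (deg i) l) t
    span-weaken w (plus u v t)   = plus (span-weaken w u) (span-weaken w v) t

    span-zero : ∀ {e d f} → d < e → Span e d f → ∀ ε → f ε ≡ 0ℚ
    span-zero d<e (none z) = z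
    span-zero {e} d<e (term b i l t) ε with () ← ℕₚ.<⇒≱ d<e (ℕₚ.≤-trans (ℕₚ.m≤n+m e (deg i)) l)
    span-zero d<e (plus u v t) ε = trans (t ε) (cong₂ _+_ (span-zero d<e u ε) (span-zero d<e v ε))

    module Product (_∙_ : I → I → I) (deg-∙ : ∀ i j → deg (i ∙ j) ≡ deg i ℕ.+ deg j)
      (ev-∙ : ∀ i j ε → ev (i ∙ j) ε ≡ ev i ε * ev j ε) where

      span-· : ∀ {e e′ d d′ f g} → Span e d f → Span e′ d′ g → Span (e ℕ.+ e′) (d ℕ.+ d′) (λ ε → f ε * g ε)
      span-· {f = f} {g} (none z) v = none (λ ε → trans (cong (_* g ε) (z ε)) (*-zeroˡ (g ε)))
      span-· {g = g} (plus {f₁} {f₂} u₁ u₂ t) v =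
        plus (span-· u₁ v) (span-· u₂ v) (λ ε → trans (cong (_* g ε) (t ε)) (ℚₚ.*-distribʳ-+ (g ε) (f₁ ε) (f₂ ε)))
      span-· {f = f} (term b i l t) (none z) = none (λ ε → trans (cong (f ε *_) (z ε)) (*-zeroʳ (f ε)))
      span-· {f = f} u@(term b i l t) (plus {g₁} {g₂} v₁ v₂ t′) =
        plus (span-· u v₁) (span-· u v₂) (λ ε → trans (cong (f ε *_) (t′ ε)) (ℚₚ.*-distribˡ-+ (f ε) (g₁ ε) (g₂ ε)))
      span-· {e} {e′} {d} {d′} (term b i l t) (term b′ j l′ t′) = term (b * b′) (i ∙ j)
        (subst (_≤ d ℕ.+ d′) (sym shuffle) (ℕₚ.+-mono-≤ l l′))
        (λ ε → trans (cong₂ _*_ (t ε) (t′ ε))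
            (trans (*-interchange b (ev i ε) b′ (ev j ε)) (cong (b * b′ *_) (sym (ev-∙ i j ε)))))
        where
        shuffle : deg (i ∙ j) ℕ.+ (e ℕ.+ e′) ≡ deg i ℕ.+ e ℕ.+ (deg j ℕ.+ e′)
        shuffle = trans (cong (ℕ._+ (e ℕ.+ e′)) (deg-∙ i j))
          (ℕ+-interchange (deg i) (deg j) e e′)

  mono : List ℕ → (ℕ → ℚ) → ℚ
  mono []      s = 1ℚ
  mono (k ∷ δ) s = s k * mono δ s

  mono-++ : ∀ δ δ′ s → mono (δ ++ δ′) s ≡ mono δ s * mono δ′ s
  mono-++ []      δ′ s = sym (*-identityˡ (mono δ′ s))
  mono-++ (k ∷ δ) δ′ s = trans (cong (s k *_) (mono-++ δ δ′ s)) (sym (*-assoc (s k) (mono δ s) (mono δ′ s)))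

  size-++ : ∀ δ δ′ → size (δ ++ δ′) ≡ size δ ℕ.+ size δ′
  size-++ []      δ′ = refl
  size-++ (k ∷ δ) δ′ = trans (cong (k ℕ.+_) (size-++ δ δ′)) (sym (ℕₚ.+-assoc k (size δ) (size δ′)))

  ^-+ : ∀ x m n → x ^ (m ℕ.+ n) ≡ x ^ m * x ^ n
  ^-+ x zero    n = sym (*-identityˡ (x ^ n))
  ^-+ x (suc m) n = trans (cong (x *_) (^-+ x m n)) (sym (*-assoc x (x ^ m) (x ^ n)))

  module Poly = Graded size mono
  module PolyProduct = Poly.Product _++_ size-++ mono-++

  deg₂ : List ℕ × ℕ → ℕ
  deg₂ (δ , i) = size δ ℕ.+ i

  mono₂ : List ℕ × ℕ → (ℕ → ℚ) × ℚ → ℚ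
  mono₂ (δ , i) (s , x) = mono δ s * x ^ i

  _∙_ : List ℕ × ℕ → List ℕ × ℕ → List ℕ × ℕ
  (δ , i) ∙ (δ′ , i′) = δ ++ δ′ , i ℕ.+ i′

  deg₂-∙ : ∀ m m′ → deg₂ (m ∙ m′) ≡ deg₂ m ℕ.+ deg₂ m′
  deg₂-∙ (δ , i) (δ′ , i′) = trans (cong (ℕ._+ (i ℕ.+ i′)) (size-++ δ δ′)) (ℕ+-interchange (size δ) (size δ′) i i′)

  mono₂-∙ : ∀ m m′ ε → mono₂ (m ∙ m′) ε ≡ mono₂ m ε * mono₂ m′ ε
  mono₂-∙ (δ , i) (δ′ , i′) (s , x) =
    trans (cong₂ _*_ (mono-++ δ δ′ s) (^-+ x i i′)) (*-interchange (mono δ s) (mono δ′ s) (x ^ i) (x ^ i′))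

  module PolyX = Graded deg₂ mono₂
  module PolyXProduct = PolyX.Product _∙_ deg₂-∙ mono₂-∙

  -- `F` is quantified before `s` and `M`: one polynomial serves all partitions.
  Moment : ℕ → Set
  Moment k = Σ ((ℕ → ℚ) → ℚ) (λ F → Poly.Span 0 k F ×
    (∀ s M → Newton (s ∘ suc) M → M k ≡ F s * M 0))

  var-span : ∀ k d → k ≤ d → Poly.Span 0 d (λ s → s k)
  var-span k d k≤d = Poly.term 1ℚ (k ∷ [])
    (subst (_≤ d) (sym (trans (ℕₚ.+-identityʳ (k ℕ.+ 0)) (ℕₚ.+-identityʳ k))) k≤d) (λ s → ring (s k))
    where
    ring : ∀ x → x ≡ 1ℚ * (x * 1ℚ)
    ring = solve-∀ ℚ-ring

  -- `f` and `d` record how far the recursion of `conv` has shifted its first argument; `d` grows by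
  -- one whenever `k` drops by one, so the total degree is preserved.
  conv-span : ∀ k d (f : ℕ → ℕ) → (∀ j → f j ≤ j ℕ.+ d) → (∀ j → j ≤ k → Moment j) →
    Σ ((ℕ → ℚ) → ℚ) (λ F → Poly.Span 0 (k ℕ.+ d) F ×
      (∀ s M → Newton (s ∘ suc) M → conv (s ∘ f) M k ≡ F s * M 0))
  conv-span zero d f f≤ moments = (λ s → s (f 0)) , var-span (f 0) d (f≤ 0) , λ s M _ → refl
  conv-span (suc k) d f f≤ moments
    with F , spanF , eqF ← moments (suc k) ℕₚ.≤-refl
    with G , spanG , eqG ← conv-span k (suc d) (f ∘ suc) (λ j → subst (f (suc j) ≤_) (sym (ℕₚ.+-suc j d)) (f≤ (suc j)))
                             (λ j j≤k → moments j (ℕₚ.m≤n⇒m≤1+n j≤k)) =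
    (λ s → s (f 0) * F s + G s) ,
    Poly.span-+ (subst (λ n → Poly.Span 0 n (λ s → s (f 0) * F s)) (ℕₚ.+-comm d (suc k))
               (PolyProduct.span-· (var-span (f 0) d (f≤ 0)) spanF))
             (subst (λ n → Poly.Span 0 n G) (ℕₚ.+-suc k d) spanG) ,
    λ s M nM → trans (cong₂ (λ y z → s (f 0) * y + z) (eqF s M nM) (eqG s M nM)) (ring (s (f 0)) (F s) (G s) (M 0))
    where
    ring : ∀ a b c d → a * (b * d) + c * d ≡ (a * b + c) * d
    ring = solve-∀ ℚ-ring

  abstract
    moment-span : ∀ k → Moment k
    moment-span = <-rec Moment step
      where
      step : ∀ k → (∀ {j} → j < k → Moment j) → Moment k
      step zero    _   = (λ _ → 1ℚ) , Poly.term 1ℚ [] z≤n (λ _ → refl) , λ s M _ → sym (*-identityˡ (M 0))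
      step (suc k) rec
        with F , spanF , eqF ← conv-span k 1 suc (λ j → ℕₚ.≤-reflexive (ℕₚ.+-comm 1 j)) (λ j j≤k → rec (s≤s j≤k)) =
        -- Solving Newton's identity for the top moment divides by k + 1; hence coefficients in ℚ.
        (λ s → 1/suc k * F s) , Poly.span-* (1/suc k) (subst (λ n → Poly.Span 0 n F) (ℕₚ.+-comm k 1) spanF) ,
        λ s M nM → begin
          M (suc k)                                ≡⟨ sym (*-identityˡ (M (suc k))) ⟩
          1ℚ * M (suc k)                           ≡⟨ cong (_* M (suc k)) (sym (ι-inverse k)) ⟩
          ι (suc k) * 1/suc k * M (suc k)          ≡⟨ ring (ι (suc k)) (1/suc k) (M (suc k)) ⟩
          1/suc k * (ι (suc k) * M (suc k))        ≡⟨ cong (1/suc k *_) (nM k) ⟩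
          1/suc k * conv (s ∘ suc) M k             ≡⟨ cong (1/suc k *_) (eqF s M nM) ⟩
          1/suc k * (F s * M 0)                    ≡⟨ sym (*-assoc (1/suc k) (F s) (M 0)) ⟩
          1/suc k * F s * M 0                      ∎
        where
        ring : ∀ a b c → a * b * c ≡ b * (a * c)
        ring = solve-∀ ℚ-ring

  -- Change of a monomial when a box is added

  ∇ : ℕ → ℚ → ℚ
  ∇ k x = (x + 1ℚ) ^ k - (x - 1ℚ) ^ k

  weaken-d : ∀ {e d f} → PolyX.Span e d f → PolyX.Span (suc e) (suc d) f
  weaken-d {e} {d} = PolyX.span-weaken (λ n l → subst (_≤ suc d) (sym (ℕₚ.+-suc n e)) (s≤s l))

  x-span : PolyX.Span 0 1 proj₂
  x-span = PolyX.term 1ℚ ([] , 1) ℕₚ.≤-refl (λ ε → ring (proj₂ ε))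
    where
    ring : ∀ x → x ≡ 1ℚ * (1ℚ * (x * 1ℚ))
    ring = solve-∀ ℚ-ring

  -- A joint induction: Δ at k + 1 is x Δ + ∇ at k, and ∇ at k + 1 is x ∇ + Δ + 2 x^k at k. Thus the
  -- cancellation of leading powers needs no binomial expansion.
  Δ-span : ∀ k → PolyX.Span 2 k (λ ε → Δ k (proj₂ ε))
  ∇-span : ∀ k → PolyX.Span 1 k (λ ε → ∇ k (proj₂ ε))

  Δ-span zero    = PolyX.none (λ _ → refl)
  Δ-span (suc k) = PolyX.plus (PolyXProduct.span-· x-span (Δ-span k)) (weaken-d (∇-span k))
    (λ ε → ring (proj₂ ε) ((proj₂ ε + 1ℚ) ^ k) ((proj₂ ε - 1ℚ) ^ k) (proj₂ ε ^ k))
    where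
    ring : ∀ x u v y → (x + 1ℚ) * u + (x - 1ℚ) * v - (x * y + x * y) ≡ x * (u + v - (y + y)) + (u - v)
    ring = solve-∀ ℚ-ring

  ∇-span zero    = PolyX.none (λ _ → refl)
  ∇-span (suc k) = PolyX.plus (PolyX.span-+ (PolyXProduct.span-· x-span (∇-span k))
      (PolyX.span-weaken (λ n l → ℕₚ.≤-trans (ℕₚ.+-monoʳ-≤ n (s≤s z≤n)) (ℕₚ.m≤n⇒m≤1+n l)) (Δ-span k)))
    (PolyX.term (1ℚ + 1ℚ) ([] , k) (ℕₚ.≤-reflexive (ℕₚ.+-comm k 1)) (λ _ → refl))
    (λ ε → ring (proj₂ ε) ((proj₂ ε + 1ℚ) ^ k) ((proj₂ ε - 1ℚ) ^ k) (proj₂ ε ^ k))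
    where
    ring : ∀ x u v y → (x + 1ℚ) * u - (x - 1ℚ) * v ≡ x * (u - v) + (u + v - (y + y)) + (1ℚ + 1ℚ) * (1ℚ * y)
    ring = solve-∀ ℚ-ring

  shift : (ℕ → ℚ) × ℚ → ℕ → ℚ
  shift (s , x) k = s k + Δ k x

  mono₂-span : ∀ ν → PolyX.Span 0 (size ν) (λ ε → mono ν (proj₁ ε))
  mono₂-span ν = PolyX.term 1ℚ (ν , 0) (ℕₚ.≤-reflexive (trans (ℕₚ.+-identityʳ _) (ℕₚ.+-identityʳ _)))
    (λ ε → ring (mono ν (proj₁ ε)))
    where
    ring : ∀ x → x ≡ 1ℚ * (x * 1ℚ)
    ring = solve-∀ ℚ-ring

  -- Discrete product rule: (s + d) m′ - s m = (s + d) (m′ - m) + d m. Each summand has one factor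
  -- that already lost two degrees, so the other is used only with its plain degree bound.
  shift-span : ∀ ν → PolyX.Span 2 (size ν) (λ ε → mono ν (shift ε) - mono ν (proj₁ ε))
  shift-span []      = PolyX.none (λ _ → refl)
  shift-span (k ∷ ν) = PolyX.plus
    (PolyXProduct.span-· (PolyX.span-+
                              (subst (λ n → PolyX.Span 0 n (λ ε → proj₁ ε k * 1ℚ)) (ℕₚ.+-identityʳ k) (mono₂-span (k ∷ [])))
                           (PolyX.span-weaken (λ n → ℕₚ.≤-trans (ℕₚ.+-monoʳ-≤ n z≤n)) (Δ-span k)))
                (shift-span ν))
    (PolyXProduct.span-· (Δ-span k) (mono₂-span ν))
    (λ ε → ring (proj₁ ε k) (Δ k (proj₂ ε)) (mono ν (shift ε)) (mono ν (proj₁ ε)))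
    where
    ring : ∀ s d m′ m → (s + d) * m′ - s * m ≡ (s * 1ℚ + d) * (m′ - m) + d * m
    ring = solve-∀ ℚ-ring

  -- The operator `D` on polynomials in the q_k

  q̃ : List ℕ → ℕ → ℚ
  q̃ = rowPower 0ℚ

  q̃-add : ∀ {λs μ x} → Add λs μ x → ∀ k → q̃ μ k ≡ shift (q̃ λs , x) k
  q̃-add {λs} {x = x} s k = trans (rowPower-add s 0ℚ k) (cong (λ y → q̃ λs k + Δ k y) (+-identityʳ x))

  mono-cong : ∀ δ {s s′} → (∀ k → s k ≡ s′ k) → mono δ s ≡ mono δ s′
  mono-cong []      eq = refl
  mono-cong (k ∷ δ) eq = cong₂ _*_ (eq k) (mono-cong δ eq)

  -- The q's of λ are constant in the sum, so only x^i is averaged, and its moment polynomial again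
  -- has degree at most i; the bounds survive unchanged.
  Σ⁺-span : ∀ {e d W} → PolyX.Span e d W → Σ ((ℕ → ℚ) → ℚ) (λ G → Poly.Span e d G ×
    (∀ λs → Σ⁺ (λ μ x → W (q̃ λs , x) * h μ) λs ≡ G (q̃ λs) * h λs))
  Σ⁺-span (PolyX.none z) = (λ _ → 0ℚ) , Poly.none (λ _ → refl) , λ λs → begin
    Σ⁺ _ λs ≡⟨ Σ⁺-cong λs (λ {μ} {x} _ → trans (cong (_* h μ) (z _)) (trans (*-zeroˡ (h μ)) (sym (*-zeroˡ (h μ))))) ⟩
    Σ⁺ (λ μ x → 0ℚ * h μ) λs ≡⟨ Σ⁺-* 0ℚ _ λs ⟩
    0ℚ * Σ⁺ (λ μ x → h μ) λs ≡⟨ cong (0ℚ *_) (Σ⁺-h λs) ⟩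
    0ℚ * h λs ∎
  Σ⁺-span (PolyX.term b (δ , i) l t)
    with F , spanF , eqF ← moment-span i =
    (λ s → b * (mono δ s * F s)) ,
    Poly.span-* b (Poly.span-weaken (λ n n≤ → ℕₚ.≤-trans (ℕₚ.+-monoˡ-≤ _ (subst (_≤ size δ ℕ.+ i) (ℕₚ.+-identityʳ n) n≤)) l)
      (PolyProduct.span-· {f = mono δ}
        (Poly.term 1ℚ δ (ℕₚ.≤-reflexive (ℕₚ.+-identityʳ _)) (λ s → sym (*-identityˡ _))) spanF)) ,
    λ λs → begin
      Σ⁺ _ λs
        ≡⟨ Σ⁺-cong λs (λ {μ} {x} _ → trans (cong (_* h μ) (t _)) (trans (ring (b) (mono δ (q̃ λs)) (x ^ i) (h μ))
             (cong (λ y → b * mono δ (q̃ λs) * (y ^ i * h μ)) (sym (+-identityʳ x))))) ⟩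
      Σ⁺ (λ μ x → b * mono δ (q̃ λs) * ((x + 0ℚ) ^ i * h μ)) λs
        ≡⟨ Σ⁺-* (b * mono δ (q̃ λs)) _ λs ⟩
      b * mono δ (q̃ λs) * moment 0ℚ λs i
        ≡⟨ cong (b * mono δ (q̃ λs) *_) (trans (eqF (q̃ λs) _ (moment-newton 0ℚ λs)) (cong (F (q̃ λs) *_) (moment-0 0ℚ λs))) ⟩
      b * mono δ (q̃ λs) * (F (q̃ λs) * h λs)
        ≡⟨ ring₂ b (mono δ (q̃ λs)) (F (q̃ λs)) (h λs) ⟩
      b * (mono δ (q̃ λs) * F (q̃ λs)) * h λs ∎
    where
    ring : ∀ b m x h → b * (m * x) * h ≡ b * m * (x * h)
    ring = solve-∀ ℚ-ring
    ring₂ : ∀ b m x h → b * m * (x * h) ≡ b * (m * x) * h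
    ring₂ = solve-∀ ℚ-ring
  Σ⁺-span (PolyX.plus {f} {g} u v t)
    with F , spanF , eqF ← Σ⁺-span u | G , spanG , eqG ← Σ⁺-span v =
    (λ s → F s + G s) , Poly.span-+ spanF spanG , λ λs → begin
      Σ⁺ _ λs
        ≡⟨ Σ⁺-cong λs (λ {μ} {x} _ → trans (cong (_* h μ) (t (q̃ λs , x)))
             (ℚₚ.*-distribʳ-+ (h μ) (f (q̃ λs , x)) (g (q̃ λs , x)))) ⟩
      Σ⁺ (λ μ x → f (q̃ λs , x) * h μ + g (q̃ λs , x) * h μ) λs
        ≡⟨ Σ⁺-+ _ _ λs ⟩
      Σ⁺ (λ μ x → f (q̃ λs , x) * h μ) λs + Σ⁺ (λ μ x → g (q̃ λs , x) * h μ) λs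
        ≡⟨ cong₂ _+_ (eqF λs) (eqG λs) ⟩
      F (q̃ λs) * h λs + G (q̃ λs) * h λs
        ≡⟨ sym (ℚₚ.*-distribʳ-+ (h λs) (F (q̃ λs)) (G (q̃ λs))) ⟩
      (F (q̃ λs) + G (q̃ λs)) * h λs ∎

  -- On partitions this is `D` applied to `F (q̃ μ) * h μ`, but the sum runs over all rows.
  ∂ : ((ℕ → ℚ) → ℚ) → List ℕ → ℚ
  ∂ F λs = Σ⁺ (λ μ _ → F (q̃ μ) * h μ) λs - F (q̃ λs) * h λs

  abstract
    ∂-mono : ∀ ν → Σ ((ℕ → ℚ) → ℚ) (λ G → Poly.Span 2 (size ν) G × (∀ λs → ∂ (mono ν) λs ≡ G (q̃ λs) * h λs))
    ∂-mono ν with G , spanG , eqG ← Σ⁺-span (shift-span ν) = G , spanG , λ λs → begin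
      Σ⁺ (λ μ _ → mono ν (q̃ μ) * h μ) λs - mono ν (q̃ λs) * h λs
        ≡⟨ cong (_- mono ν (q̃ λs) * h λs) (Σ⁺-cong λs (λ {μ} {x} s →
             trans (cong (_* h μ) (mono-cong ν (q̃-add s))) (ring (mono ν (shift (q̃ λs , x))) (mono ν (q̃ λs)) (h μ)))) ⟩
      Σ⁺ (λ μ x → mono ν (q̃ λs) * h μ + (mono ν (shift (q̃ λs , x)) - mono ν (q̃ λs)) * h μ) λs - mono ν (q̃ λs) * h λs
        -- By `Σ⁺-h` the unchanged part sums to the very term that is subtracted; only the change of
        -- the monomial remains.
        ≡⟨ cong (_- mono ν (q̃ λs) * h λs) (trans (Σ⁺-+ (λ μ _ → mono ν (q̃ λs) * h μ)
               (λ μ x → (mono ν (shift (q̃ λs , x)) - mono ν (q̃ λs)) * h μ) λs) (cong₂ _+_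
             (trans (Σ⁺-* (mono ν (q̃ λs)) (λ μ _ → h μ) λs) (cong (mono ν (q̃ λs) *_) (Σ⁺-h λs))) (eqG λs))) ⟩
      mono ν (q̃ λs) * h λs + G (q̃ λs) * h λs - mono ν (q̃ λs) * h λs
        ≡⟨ ring₂ (mono ν (q̃ λs) * h λs) (G (q̃ λs) * h λs) ⟩
      G (q̃ λs) * h λs ∎
      where
      ring : ∀ a b h → a * h ≡ b * h + (a - b) * h
      ring = solve-∀ ℚ-ring
      ring₂ : ∀ a b → a + b - a ≡ b
      ring₂ = solve-∀ ℚ-ring

  ∂-span : ∀ {e d F} → Poly.Span e d F → Σ ((ℕ → ℚ) → ℚ) (λ G → Poly.Span (2 ℕ.+ e) d G ×
    (∀ λs → ∂ F λs ≡ G (q̃ λs) * h λs))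
  ∂-span {F = F} (Poly.none z) = (λ _ → 0ℚ) , Poly.none (λ _ → refl) , λ λs → begin
    ∂ F λs
      ≡⟨ cong₂ _-_ (trans (Σ⁺-cong λs (λ {μ} _ → cong (_* h μ) (z (q̃ μ)))) (Σ⁺-* 0ℚ (λ μ _ → h μ) λs))
           (cong (_* h λs) (z (q̃ λs))) ⟩
    0ℚ * Σ⁺ (λ μ _ → h μ) λs - 0ℚ * h λs
      ≡⟨ ring (Σ⁺ (λ μ _ → h μ) λs) (h λs) ⟩
    0ℚ * h λs ∎
    where
    ring : ∀ a b → 0ℚ * a - 0ℚ * b ≡ 0ℚ * b
    ring = solve-∀ ℚ-ring
  ∂-span {e} {F = F} (Poly.term b δ l t)
    with G , spanG , eqG ← ∂-mono δ =
    (λ s → b * G s) ,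
    Poly.span-* b (Poly.span-weaken (λ n n≤ → ℕₚ.≤-trans (ℕₚ.≤-reflexive (sym (ℕₚ.+-assoc n 2 e)))
      (ℕₚ.≤-trans (ℕₚ.+-monoˡ-≤ e n≤) l)) spanG) ,
    λ λs → begin
      ∂ F λs
        ≡⟨ cong₂ _-_ (trans (Σ⁺-cong λs (λ {μ} _ → trans (cong (_* h μ) (t (q̃ μ))) (*-assoc b (mono δ (q̃ μ)) (h μ))))
             (Σ⁺-* b (λ μ _ → mono δ (q̃ μ) * h μ) λs)) (cong (_* h λs) (t (q̃ λs))) ⟩
      b * Σ⁺ (λ μ _ → mono δ (q̃ μ) * h μ) λs - b * mono δ (q̃ λs) * h λs
        ≡⟨ ring b (Σ⁺ (λ μ _ → mono δ (q̃ μ) * h μ) λs) (mono δ (q̃ λs)) (h λs) ⟩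
      b * ∂ (mono δ) λs
        ≡⟨ cong (b *_) (eqG λs) ⟩
      b * (G (q̃ λs) * h λs)
        ≡⟨ sym (*-assoc b (G (q̃ λs)) (h λs)) ⟩
      b * G (q̃ λs) * h λs ∎
    where
    ring : ∀ b x m h → b * x - b * m * h ≡ b * (x - m * h)
    ring = solve-∀ ℚ-ring
  ∂-span {F = F} (Poly.plus {f} {g} u v t)
    with G₁ , span₁ , eq₁ ← ∂-span u | G₂ , span₂ , eq₂ ← ∂-span v =
    (λ s → G₁ s + G₂ s) , Poly.span-+ span₁ span₂ , λ λs → begin
      ∂ F λs
        ≡⟨ cong₂ _-_ (trans (Σ⁺-cong λs (λ {μ} _ → trans (cong (_* h μ) (t (q̃ μ))) (ℚₚ.*-distribʳ-+ (h μ) (f (q̃ μ)) (g (q̃ μ)))))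
             (Σ⁺-+ (λ μ _ → f (q̃ μ) * h μ) (λ μ _ → g (q̃ μ) * h μ) λs))
             (cong (_* h λs) (t (q̃ λs))) ⟩
      Σ⁺ (λ μ _ → f (q̃ μ) * h μ) λs + Σ⁺ (λ μ _ → g (q̃ μ) * h μ) λs - (f (q̃ λs) + g (q̃ λs)) * h λs
        ≡⟨ ring (Σ⁺ (λ μ _ → f (q̃ μ) * h μ) λs) (Σ⁺ (λ μ _ → g (q̃ μ) * h μ) λs) (f (q̃ λs)) (g (q̃ λs)) (h λs) ⟩
      ∂ f λs + ∂ g λs
        ≡⟨ cong₂ _+_ (eq₁ λs) (eq₂ λs) ⟩
      G₁ (q̃ λs) * h λs + G₂ (q̃ λs) * h λs
        ≡⟨ sym (ℚₚ.*-distribʳ-+ (h λs) (G₁ (q̃ λs)) (G₂ (q̃ λs))) ⟩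
      (G₁ (q̃ λs) + G₂ (q̃ λs)) * h λs ∎
    where
    ring : ∀ x y a b h → x + y - (a + b) * h ≡ (x - a * h) + (y - b * h)
    ring = solve-∀ ℚ-ring
  -- The hook product


  ι-+ : ∀ m n → ι (m ℕ.+ n) ≡ ι m + ι n
  ι-+ zero    n = sym (+-identityˡ (ι n))
  ι-+ (suc m) n = trans (cong (_+ 1ℚ) (ι-+ m n)) (ring (ι m) (ι n))
    where
    ring : ∀ x y → x + y + 1ℚ ≡ x + 1ℚ + y
    ring = solve-∀ ℚ-ring

  ι-* : ∀ m n → ι (m ℕ.* n) ≡ ι m * ι n
  ι-* zero    n = sym (*-zeroˡ (ι n))
  ι-* (suc m) n = trans (ι-+ n (m ℕ.* n)) (trans (cong (λ y → ι n + y) (ι-* m n)) (ring (ι m) (ι n)))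
    where
    ring : ∀ x y → y + x * y ≡ (x + 1ℚ) * y
    ring = solve-∀ ℚ-ring

  1/!-inverse : ∀ n → ι (n !) * 1/! n ≡ 1ℚ
  1/!-inverse zero    = refl
  1/!-inverse (suc n) = begin
    ι (suc n ℕ.* n !) * 1/! (suc n)           ≡⟨ cong (_* 1/! (suc n)) (ι-* (suc n) (n !)) ⟩
    (ι n + 1ℚ) * ι (n !) * 1/! (suc n)        ≡⟨ ring (ι n + 1ℚ) (ι (n !)) (1/! (suc n)) ⟩
    ι (n !) * ((ι n + 1ℚ) * 1/! (suc n))      ≡⟨ cong (ι (n !) *_) (1/!-suc n) ⟩
    ι (n !) * 1/! n                           ≡⟨ 1/!-inverse n ⟩
    1ℚ ∎
    where
    ring : ∀ x y z → x * y * z ≡ y * (x * z)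
    ring = solve-∀ ℚ-ring

  applyUpTo-cong : ∀ {A : Set} {f g : ℕ → A} n → (∀ {j} → j < n → f j ≡ g j) → applyUpTo f n ≡ applyUpTo g n
  applyUpTo-cong zero    eq = refl
  applyUpTo-cong (suc n) eq = cong₂ _∷_ (eq (s≤s z≤n)) (applyUpTo-cong n (eq ∘ s≤s))

  product-applyUpTo-+ : ∀ f m n → product (applyUpTo f (m ℕ.+ n)) ≡
    product (applyUpTo f m) ℕ.* product (applyUpTo (λ t → f (m ℕ.+ t)) n)
  product-applyUpTo-+ f zero    n = sym (ℕₚ.+-identityʳ _)
  product-applyUpTo-+ f (suc m) n =
    trans (cong (f 0 ℕ.*_) (product-applyUpTo-+ (f ∘ suc) m n)) (sym (ℕₚ.*-assoc (f 0) _ _))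

  conj-∷ : ∀ b r j → j ≤ b → conj (b ∷ r) j ≡ suc (conj r j)
  conj-∷ b r j j≤b = cong length (filter-accept (T? ∘ (j ≤ᵇ_)) (ℕₚ.≤⇒≤ᵇ j≤b))

  conj-beyond : ∀ r j → All (_< j) r → conj r j ≡ 0
  conj-beyond r j all = cong length (filter-none (T? ∘ (j ≤ᵇ_))
    (All.map (λ {b} b<j t → ℕₚ.<⇒≱ b<j (ℕₚ.≤ᵇ⇒≤ j b t)) all))

  parts-≤ : ∀ {a r} → Linked _≥_ (a ∷ r) → All (_≤ a) r
  parts-≤ {a} l = All.tail (Linked⇒All (flip ℕₚ.≤-trans) (ℕₚ.≤-refl {a}) l)

  armLegs-row : ∀ λs i b → map (λ j → (b ∸ j) ℕ.+ (conj λs j ∸ i)) (map suc (upTo b)) ≡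
    applyUpTo (λ j → (b ∸ suc j) ℕ.+ (conj λs (suc j) ∸ i)) b
  armLegs-row λs i b = trans (cong (map (λ j → (b ∸ j) ℕ.+ (conj λs j ∸ i))) (map-applyUpTo id suc b))
    (map-applyUpTo suc (λ j → (b ∸ j) ℕ.+ (conj λs j ∸ i)) b)

  -- A row on top that covers all columns of `r` raises column heights and row indices alike by one,
  -- so legs are unaffected.
  armLegs-∷ : ∀ a λs i r → All (_≤ a) r → armLegs (a ∷ λs) (suc i) r ≡ armLegs λs i r
  armLegs-∷ a λs i []      _          = refl
  armLegs-∷ a λs i (b ∷ r) (b≤a ∷ all) = cong₂ _++_
    (trans (armLegs-row (a ∷ λs) (suc i) b)
      (trans (applyUpTo-cong b (λ {j} j<b →
                cong (λ m → (b ∸ suc j) ℕ.+ (m ∸ suc i)) (conj-∷ a λs (suc j) (ℕₚ.≤-trans j<b b≤a))))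
             (sym (armLegs-row λs i b))))
    (armLegs-∷ a λs (suc i) r all)

  -- Hooks of a row of length a on top of r, all arms being enlarged by c.
  rowHooks : ℕ → ℕ → List ℕ → ℕ
  rowHooks a c r = product (applyUpTo (λ j → suc ((a ∸ suc j) ℕ.+ c ℕ.+ conj r (suc j))) a)

  H-∷ : ∀ a r → All (_≤ a) r → H (a ∷ r) ≡ rowHooks a 0 r ℕ.* H r
  H-∷ a r all = begin
    product (map suc (row ++ armLegs (a ∷ r) 2 r))
      ≡⟨ cong product (map-++ suc row (armLegs (a ∷ r) 2 r)) ⟩
    product (map suc row ++ map suc (armLegs (a ∷ r) 2 r))
      ≡⟨ product-++ (map suc row) (map suc (armLegs (a ∷ r) 2 r)) ⟩
    product (map suc row) ℕ.* product (map suc (armLegs (a ∷ r) 2 r))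
      ≡⟨ cong₂ (λ u v → product u ℕ.* product (map suc v)) rowEq (armLegs-∷ a r 1 r all) ⟩
    rowHooks a 0 r ℕ.* H r ∎
    where
    row = map (λ j → (a ∸ j) ℕ.+ (conj (a ∷ r) j ∸ 1)) (map suc (upTo a))
    rowEq : map suc row ≡ applyUpTo (λ j → suc ((a ∸ suc j) ℕ.+ 0 ℕ.+ conj r (suc j))) a
    rowEq = trans (cong (map suc) (armLegs-row (a ∷ r) 1 a))
      (trans (map-applyUpTo _ suc a)
        (applyUpTo-cong a (λ {j} j<a → cong suc (cong₂ ℕ._+_ (sym (ℕₚ.+-identityʳ (a ∸ suc j)))
          (cong (_∸ 1) (conj-∷ a r (suc j) j<a))))))

  rising : ∀ d c → product (applyUpTo (λ t → suc ((d ∸ suc t) ℕ.+ c)) d) ℕ.* c ! ≡ (d ℕ.+ c) !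
  rising zero    c = ℕₚ.+-identityʳ (c !)
  rising (suc d) c = trans
    (ℕₚ.*-assoc (suc (d ℕ.+ c)) (product (applyUpTo (λ t → suc ((d ∸ suc t) ℕ.+ c)) d)) (c !))
    (cong (suc (d ℕ.+ c) ℕ.*_) (rising d c))

  rowHooks-[] : ∀ a c → rowHooks a c [] ℕ.* c ! ≡ (a ℕ.+ c) !
  rowHooks-[] a c = trans
    (cong (λ l → product l ℕ.* c !) (applyUpTo-cong a (λ {j} _ → cong suc (ℕₚ.+-identityʳ ((a ∸ suc j) ℕ.+ c)))))
    (rising a c)

  -- The d columns overhanging the row below have no leg and contribute (d + c)! / c!. In the first
  -- b columns the overhang d and the one leg box in row b are absorbed into the arm enlargement,
  -- which becomes d + c + 1.
  rowHooks-∷ : ∀ b d c r → All (_≤ b) r →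
    rowHooks (b ℕ.+ d) c (b ∷ r) ℕ.* c ! ≡ rowHooks b (suc (d ℕ.+ c)) r ℕ.* (d ℕ.+ c) !
  rowHooks-∷ b d c r all = begin
    product (applyUpTo f (b ℕ.+ d)) ℕ.* c !
      ≡⟨ cong (ℕ._* c !) (product-applyUpTo-+ f b d) ⟩
    product (applyUpTo f b) ℕ.* product (applyUpTo (λ t → f (b ℕ.+ t)) d) ℕ.* c !
      ≡⟨ ℕₚ.*-assoc (product (applyUpTo f b)) _ (c !) ⟩
    product (applyUpTo f b) ℕ.* (product (applyUpTo (λ t → f (b ℕ.+ t)) d) ℕ.* c !)
      ≡⟨ cong₂ (λ u v → product u ℕ.* (product v ℕ.* c !)) (applyUpTo-cong b left) (applyUpTo-cong d right) ⟩
    rowHooks b (suc (d ℕ.+ c)) r ℕ.* (product (applyUpTo (λ t → suc ((d ∸ suc t) ℕ.+ c)) d) ℕ.* c !)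
      ≡⟨ cong (rowHooks b (suc (d ℕ.+ c)) r ℕ.*_) (rising d c) ⟩
    rowHooks b (suc (d ℕ.+ c)) r ℕ.* (d ℕ.+ c) ! ∎
    where
    f : ℕ → ℕ
    f j = suc ((b ℕ.+ d ∸ suc j) ℕ.+ c ℕ.+ conj (b ∷ r) (suc j))
    left : ∀ {j} → j < b → f j ≡ suc ((b ∸ suc j) ℕ.+ suc (d ℕ.+ c) ℕ.+ conj r (suc j))
    left {j} j<b = cong suc (trans
      (cong₂ (λ m n → m ℕ.+ c ℕ.+ n) (ℕₚ.+-∸-comm d j<b) (conj-∷ b r (suc j) j<b))
      (arith (b ∸ suc j) d c (conj r (suc j))))
      where
      arith : ∀ w x y z → w ℕ.+ x ℕ.+ y ℕ.+ suc z ≡ w ℕ.+ suc (x ℕ.+ y) ℕ.+ z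
      arith = ℕ-Solver.solve-∀
    right : ∀ {t} → t < d → f (b ℕ.+ t) ≡ suc ((d ∸ suc t) ℕ.+ c)
    right {t} t<d = cong suc (trans
      (cong₂ (λ m n → m ℕ.+ c ℕ.+ n)
        (trans (cong (b ℕ.+ d ∸_) (sym (ℕₚ.+-suc b t))) (ℕₚ.[m+n]∸[m+o]≡n∸o b d (suc t)))
        (conj-beyond (b ∷ r) (suc (b ℕ.+ t))
          (s≤s (ℕₚ.m≤m+n b t) ∷ All.map (λ x≤b → s≤s (ℕₚ.≤-trans x≤b (ℕₚ.m≤m+n b t))) all)))
      (ℕₚ.+-identityʳ ((d ∸ suc t) ℕ.+ c)))

  -- The enlargement `c` makes the induction possible: each row below passes into it, and the factor
  -- e + 1 of `ρ` turns e! into the next factorial. At c = 0 this is the classical ℓ! / Π (ℓ - ℓ_j)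
  -- for the hooks of one row.
  rowHooks-ρ : ∀ a c r → Linked _≥_ (a ∷ r) → ι (rowHooks a c r ℕ.* c !) * ρ (a ℕ.+ c) r ≡ 1ℚ
  rowHooks-ρ a c []      _         = trans (cong (λ m → ι m * 1/! (a ℕ.+ c)) (rowHooks-[] a c)) (1/!-inverse (a ℕ.+ c))
  rowHooks-ρ a c (b ∷ r) (a≥b ∷ l) with d , refl ← ℕₚ.m≤n⇒∃[o]m+o≡n a≥b = begin
    ι (rowHooks (b ℕ.+ d) c (b ∷ r) ℕ.* c !) * ((ι (b ℕ.+ d ℕ.+ c) - ι b + 1ℚ) * ρ (suc (b ℕ.+ d ℕ.+ c)) r)
      ≡⟨ cong₂ (λ m n → ι m * ((ι n - ι b + 1ℚ) * ρ (suc n) r)) (rowHooks-∷ b d c r (parts-≤ l)) (ℕₚ.+-assoc b d c) ⟩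
    ι (rowHooks b (suc e) r ℕ.* e !) * ((ι (b ℕ.+ e) - ι b + 1ℚ) * ρ (suc (b ℕ.+ e)) r)
      ≡⟨ cong₂ (λ x y → x * ((y - ι b + 1ℚ) * ρ (suc (b ℕ.+ e)) r)) (ι-* (rowHooks b (suc e) r) (e !)) (ι-+ b e) ⟩
    ι (rowHooks b (suc e) r) * ι (e !) * ((ι b + ι e - ι b + 1ℚ) * ρ (suc (b ℕ.+ e)) r)
      ≡⟨ ring (ι (rowHooks b (suc e) r)) (ι (e !)) (ι b) (ι e) (ρ (suc (b ℕ.+ e)) r) ⟩
    ι (rowHooks b (suc e) r) * ((ι e + 1ℚ) * ι (e !)) * ρ (suc (b ℕ.+ e)) r
      ≡⟨ cong (_* ρ (suc (b ℕ.+ e)) r) (trans (cong (ι (rowHooks b (suc e) r) *_) (sym (ι-* (suc e) (e !))))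
           (sym (ι-* (rowHooks b (suc e) r) (suc e !)))) ⟩
    ι (rowHooks b (suc e) r ℕ.* suc e !) * ρ (suc (b ℕ.+ e)) r
      ≡⟨ cong (λ m → ι (rowHooks b (suc e) r ℕ.* suc e !) * ρ m r) (sym (ℕₚ.+-suc b e)) ⟩
    ι (rowHooks b (suc e) r ℕ.* suc e !) * ρ (b ℕ.+ suc e) r
      ≡⟨ rowHooks-ρ b (suc e) r l ⟩
    1ℚ ∎
    where
    e = d ℕ.+ c
    ring : ∀ w x b e y → w * x * ((b + e - b + 1ℚ) * y) ≡ w * ((e + 1ℚ) * x) * y
    ring = solve-∀ ℚ-ring

  H-h : ∀ λs → Linked _≥_ λs → ι (H λs) * h λs ≡ 1ℚ
  H-h []      _ = refl
  H-h (a ∷ r) l = begin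
    ι (H (a ∷ r)) * (ρ a r * h r)
      ≡⟨ cong (λ m → ι m * (ρ a r * h r)) (H-∷ a r (parts-≤ l)) ⟩
    ι (rowHooks a 0 r ℕ.* H r) * (ρ a r * h r)
      ≡⟨ cong (_* (ρ a r * h r)) (ι-* (rowHooks a 0 r) (H r)) ⟩
    ι (rowHooks a 0 r) * ι (H r) * (ρ a r * h r)
      ≡⟨ *-interchange (ι (rowHooks a 0 r)) (ι (H r)) (ρ a r) (h r) ⟩
    ι (rowHooks a 0 r) * ρ a r * (ι (H r) * h r)
      ≡⟨ cong₂ (λ m n → ι m * ρ n r * (ι (H r) * h r)) (sym (ℕₚ.*-identityʳ (rowHooks a 0 r))) (sym (ℕₚ.+-identityʳ a)) ⟩
    ι (rowHooks a 0 r ℕ.* 0 !) * ρ (a ℕ.+ 0) r * (ι (H r) * h r)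
      ≡⟨ cong₂ _*_ (rowHooks-ρ a 0 r l) (H-h r (Linked.tail l)) ⟩
    1ℚ ∎

  /H-h : ∀ z λs → Linked _≥_ λs → z /H λs ≡ fromℤ z * h λs
  /H-h z λs l = begin
    z /H λs                            ≡⟨ sym (*-identityʳ (z /H λs)) ⟩
    z /H λs * 1ℚ                       ≡⟨ cong (z /H λs *_) (sym (H-h λs l)) ⟩
    z /H λs * (ι (H λs) * h λs)        ≡⟨ sym (*-assoc (z /H λs) (ι (H λs)) (h λs)) ⟩
    z /H λs * ι (H λs) * h λs          ≡⟨ cong (λ y → z /H λs * y * h λs) (sym (ι-fromℤ (H λs))) ⟩
    z /H λs * fromℤ (+ H λs) * h λs    ≡⟨ cong (_* h λs) (/-* z (H λs) {{H-nonZero λs}}) ⟩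
    fromℤ z * h λs ∎
  -- Corners and rows


  -- `γ` stands in for α_{m+1} = 0, so that a corner can be appended at the end.
  xsum : (ℤ → ℤ) → ℕ → List (ℕ × ℕ) → ℕ → ℤ
  xsum f β []              γ = f (+ β ℤ.- + γ)
  xsum f β ((α , β′) ∷ cs) γ = f (+ β ℤ.- + α) ℤ.+ xsum f β′ cs γ

  xsum-xsAux : ∀ f β cs → sumℤ (map f (xsAux β cs)) ≡ xsum f β cs 0
  xsum-xsAux f β []              = ℤₚ.+-identityʳ _
  xsum-xsAux f β ((α , β′) ∷ cs) = cong (λ y → f (+ β ℤ.- + α) ℤ.+ y) (xsum-xsAux f β′ cs)

  xsum-∷ʳ : ∀ f β cs i a γ → xsum f β (cs ∷ʳ (i , a)) γ ≡ xsum f β cs i ℤ.+ f (+ a ℤ.- + γ)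
  xsum-∷ʳ f β []              i a γ = refl
  xsum-∷ʳ f β ((α , β′) ∷ cs) i a γ =
    trans (cong (λ y → f (+ β ℤ.- + α) ℤ.+ y) (xsum-∷ʳ f β′ cs i a γ)) (sym (ℤₚ.+-assoc (f (+ β ℤ.- + α)) _ _))

  sumℤ-∷ʳ : ∀ {A : Set} (f : A → ℤ) xs x → sumℤ (map f (xs ∷ʳ x)) ≡ sumℤ (map f xs) ℤ.+ f x
  sumℤ-∷ʳ f []       x = ℤₚ.+-comm (f x) 0ℤ
  sumℤ-∷ʳ f (y ∷ xs) x = trans (cong (λ z → f y ℤ.+ z) (sumℤ-∷ʳ f xs x)) (sym (ℤₚ.+-assoc (f y) _ _))

  -- Corners are listed from the top here; γ is the row of the preceding corner.
  cornerSum : (ℤ → ℤ) → ℕ → List (ℕ × ℕ) → ℤ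
  cornerSum f γ []             = f (+ 0 ℤ.- + γ)
  cornerSum f γ ((i , a) ∷ cs) = f (+ a ℤ.- + γ) ℤ.- f (+ a ℤ.- + i) ℤ.+ cornerSum f i cs

  -- `y` is known only by its values, so that the anonymous function inside `ys` can be substituted
  -- for it.
  cornerSum-reverse : ∀ f (y : ℕ × ℕ → ℤ) → (∀ i a → y (i , a) ≡ + a ℤ.- + i) → ∀ γ cs →
    xsum f 0 (reverse cs) γ ℤ.- sumℤ (map f (map y (reverse cs))) ≡ cornerSum f γ cs
  cornerSum-reverse f y eq γ []             = ℤₚ.+-identityʳ _
  cornerSum-reverse f y eq γ ((i , a) ∷ cs) = begin
    xsum f 0 (reverse ((i , a) ∷ cs)) γ ℤ.- sumℤ (map f (map y (reverse ((i , a) ∷ cs))))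
      ≡⟨ cong (λ l → xsum f 0 l γ ℤ.- sumℤ (map f (map y l))) (unfold-reverse (i , a) cs) ⟩
    xsum f 0 (reverse cs ∷ʳ (i , a)) γ ℤ.- sumℤ (map f (map y (reverse cs ∷ʳ (i , a))))
      ≡⟨ cong₂ ℤ._-_ (xsum-∷ʳ f 0 (reverse cs) i a γ) ysum ⟩
    (xsum f 0 (reverse cs) i ℤ.+ f (+ a ℤ.- + γ)) ℤ.- (sumℤ (map f (map y (reverse cs))) ℤ.+ f (+ a ℤ.- + i))
      ≡⟨ arith (xsum f 0 (reverse cs) i) (f (+ a ℤ.- + γ)) (sumℤ (map f (map y (reverse cs)))) (f (+ a ℤ.- + i)) ⟩
    f (+ a ℤ.- + γ) ℤ.- f (+ a ℤ.- + i) ℤ.+ (xsum f 0 (reverse cs) i ℤ.- sumℤ (map f (map y (reverse cs))))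
      ≡⟨ cong (λ z → f (+ a ℤ.- + γ) ℤ.- f (+ a ℤ.- + i) ℤ.+ z) (cornerSum-reverse f y eq i cs) ⟩
    cornerSum f γ ((i , a) ∷ cs) ∎
    where
    arith : ∀ w x y z → (w ℤ.+ x) ℤ.- (y ℤ.+ z) ≡ x ℤ.- z ℤ.+ (w ℤ.- y)
    arith = ℤ-Solver.solve-∀
    ysum : sumℤ (map f (map y (reverse cs ∷ʳ (i , a)))) ≡ sumℤ (map f (map y (reverse cs))) ℤ.+ f (+ a ℤ.- + i)
    ysum = begin
      sumℤ (map f (map y (reverse cs ∷ʳ (i , a))))               ≡⟨ cong sumℤ (sym (map-∘ (reverse cs ∷ʳ (i , a)))) ⟩
      sumℤ (map (f ∘ y) (reverse cs ∷ʳ (i , a)))                 ≡⟨ sumℤ-∷ʳ (f ∘ y) (reverse cs) (i , a) ⟩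
      sumℤ (map (f ∘ y) (reverse cs)) ℤ.+ f (y (i , a))
        ≡⟨ cong₂ (λ u v → sumℤ u ℤ.+ f v) (map-∘ (reverse cs)) (eq i a) ⟩
      sumℤ (map f (map y (reverse cs))) ℤ.+ f (+ a ℤ.- + i)      ∎

  rowSum : (ℤ → ℤ) → ℕ → List ℕ → ℤ
  rowSum f n []      = f (+ 0 ℤ.- + n)
  rowSum f n (a ∷ r) = f (+ a ℤ.- + n) ℤ.- f (+ a ℤ.- + suc n) ℤ.+ rowSum f (suc n) r

  -- Within a block of equal rows the row terms telescope to the single pair at its corner. The
  -- difference in front accounts for the rows of the current block already passed, from γ to n.
  cornerSum-rowSum : ∀ f γ n a r → Linked _≥_ (a ∷ r) → cornerSum f γ (cornersAux (suc n) (a ∷ r)) ≡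
    f (+ a ℤ.- + γ) ℤ.- f (+ a ℤ.- + n) ℤ.+ rowSum f n (a ∷ r)
  cornerSum-rowSum f γ n a []      _         = arith (f (+ a ℤ.- + γ)) (f (+ a ℤ.- + n)) _ _
    where
    arith : ∀ x y z w → x ℤ.- z ℤ.+ w ≡ x ℤ.- y ℤ.+ (y ℤ.- z ℤ.+ w)
    arith = ℤ-Solver.solve-∀
  cornerSum-rowSum f γ n a (b ∷ r) (a≥b ∷ l) with b <ᵇ a | ℕₚ.<ᵇ-reflects-< b a
  ... | true  | _        = trans
    (cong (λ y → f (+ a ℤ.- + γ) ℤ.- f (+ a ℤ.- + suc n) ℤ.+ y) (cornerSum-rowSum f (suc n) (suc n) b r l))
    (arith (f (+ a ℤ.- + γ)) (f (+ a ℤ.- + suc n)) (f (+ b ℤ.- + suc n)) (f (+ a ℤ.- + n)) (rowSum f (suc n) (b ∷ r)))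
    where
    arith : ∀ x y z v w → x ℤ.- y ℤ.+ (z ℤ.- z ℤ.+ w) ≡ x ℤ.- v ℤ.+ (v ℤ.- y ℤ.+ w)
    arith = ℤ-Solver.solve-∀
  ... | false | ofⁿ b≮a with refl ← ℕₚ.≤-antisym a≥b (ℕₚ.≮⇒≥ b≮a) = trans
    (cornerSum-rowSum f γ (suc n) b r l)
    (arith (f (+ a ℤ.- + γ)) (f (+ a ℤ.- + suc n)) (f (+ a ℤ.- + n)) (rowSum f (suc n) (b ∷ r)))
    where
    arith : ∀ x y v w → x ℤ.- y ℤ.+ w ≡ x ℤ.- v ℤ.+ (v ℤ.- y ℤ.+ w)
    arith = ℤ-Solver.solve-∀

  q-rowSum : ∀ k λs → Linked _≥_ λs → q k λs ≡ rowSum (ℤ._^ k) 0 λs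
  q-rowSum k λs l = begin
    q k λs
      ≡⟨ cong (λ z → z ℤ.- sumℤ (map (ℤ._^ k) (ys λs))) (xsum-xsAux (ℤ._^ k) 0 (corners λs)) ⟩
    xsum (ℤ._^ k) 0 (corners λs) 0 ℤ.- sumℤ (map (ℤ._^ k) (ys λs))
      ≡⟨ cornerSum-reverse (ℤ._^ k) _ (λ _ _ → refl) 0 (cornersAux 1 λs) ⟩
    cornerSum (ℤ._^ k) 0 (cornersAux 1 λs)
      ≡⟨ start λs l ⟩
    rowSum (ℤ._^ k) 0 λs ∎
    where
    arith : ∀ x w → x ℤ.- x ℤ.+ w ≡ w
    arith = ℤ-Solver.solve-∀
    start : ∀ λs → Linked _≥_ λs → cornerSum (ℤ._^ k) 0 (cornersAux 1 λs) ≡ rowSum (ℤ._^ k) 0 λs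
    start []      _ = refl
    start (a ∷ r) l = trans (cornerSum-rowSum (ℤ._^ k) 0 0 a r l) (arith ((+ a ℤ.- + 0) ℤ.^ k) (rowSum (ℤ._^ k) 0 (a ∷ r)))

  fromℤ-- : ∀ y z → fromℤ (y ℤ.- z) ≡ fromℤ y - fromℤ z
  fromℤ-- y z = trans (fromℤ-+ y (ℤ.- z)) (cong (λ x → fromℤ y + x) (fromℤ-neg z))

  fromℤ-^ : ∀ z k → fromℤ (z ℤ.^ k) ≡ fromℤ z ^ k
  fromℤ-^ z zero    = refl
  fromℤ-^ z (suc k) = trans (fromℤ-* z (z ℤ.^ k)) (cong (fromℤ z *_) (fromℤ-^ z k))

  fromℤ-content : ∀ m n k → fromℤ ((+ m ℤ.- + n) ℤ.^ k) ≡ (ι m - ι n) ^ k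
  fromℤ-content m n k = trans (fromℤ-^ (+ m ℤ.- + n) k)
    (cong (_^ k) (trans (fromℤ-- (+ m) (+ n)) (cong₂ _-_ (ι-fromℤ m) (ι-fromℤ n))))

  rowSum-rowPower : ∀ k n λs → fromℤ (rowSum (ℤ._^ k) n λs) ≡ rowPower (- ι n) λs k
  rowSum-rowPower k n []      = trans (fromℤ-content 0 n k) (cong (_^ k) (+-identityˡ (- ι n)))
  rowSum-rowPower k n (a ∷ r) = begin
    fromℤ (u ℤ.- v ℤ.+ rowSum (ℤ._^ k) (suc n) r)
      ≡⟨ trans (fromℤ-+ (u ℤ.- v) _) (cong (_+ fromℤ (rowSum (ℤ._^ k) (suc n) r)) (fromℤ-- u v)) ⟩
    fromℤ u - fromℤ v + fromℤ (rowSum (ℤ._^ k) (suc n) r)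
      ≡⟨ cong₂ _+_ (cong₂ _-_ (fromℤ-content a n k) (fromℤ-content a (suc n) k)) (rowSum-rowPower k (suc n) r) ⟩
    (ι a - ι n) ^ k - (ι a - ι (suc n)) ^ k + rowPower (- ι (suc n)) r k
      ≡⟨ cong₂ (λ x c → (ι a - ι n) ^ k - x ^ k + rowPower c r k) (ring₁ (ι a) (ι n)) (ring₂ (ι n)) ⟩
    (ι a - ι n) ^ k - (ι a - ι n - 1ℚ) ^ k + rowPower (- ι n - 1ℚ) r k ∎
    where
    u = (+ a ℤ.- + n) ℤ.^ k
    v = (+ a ℤ.- + suc n) ℤ.^ k
    ring₁ : ∀ a n → a - (n + 1ℚ) ≡ a - n - 1ℚ
    ring₁ = solve-∀ ℚ-ring
    ring₂ : ∀ n → - (n + 1ℚ) ≡ - n - 1ℚ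
    ring₂ = solve-∀ ℚ-ring

  q-q̃ : ∀ k λs → Linked _≥_ λs → fromℤ (q k λs) ≡ q̃ λs k
  q-q̃ k λs l = trans (cong fromℤ (q-rowSum k λs l)) (rowSum-rowPower k 0 λs)

  qν-mono : ∀ ν λs → Linked _≥_ λs → fromℤ (qν ν λs) ≡ mono ν (q̃ λs)
  qν-mono []      λs l = refl
  qν-mono (k ∷ ν) λs l = trans (fromℤ-* (q k λs) (qν ν λs)) (cong₂ _*_ (q-q̃ k λs l) (qν-mono ν λs l))
  -- Adding a box to a partition


  sumℚ-filterᵇ : ∀ {A : Set} (P : A → Bool) (F : A → ℚ) xs → All (λ x → ¬ T (P x) → F x ≡ 0ℚ) xs →
    sumℚ (map F (filterᵇ P xs)) ≡ sumℚ (map F xs)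
  sumℚ-filterᵇ P F []       _          = refl
  sumℚ-filterᵇ P F (x ∷ xs) (z ∷ zs) with P x
  ... | true  = cong (λ y → F x + y) (sumℚ-filterᵇ P F xs zs)
  ... | false = trans (sumℚ-filterᵇ P F xs zs) (sym (trans (cong (_+ sumℚ (map F xs)) (z id)) (+-identityˡ _)))

  ρ-∷-overhang : ∀ a r → ρ a (suc a ∷ r) ≡ 0ℚ
  ρ-∷-overhang a r = ring (ι a) (ρ (suc a) r)
    where
    ring : ∀ a y → (a - (a + 1ℚ) + 1ℚ) * y ≡ 0ℚ
    ring = solve-∀ ℚ-ring

  -- A box overtakes the row above only when both rows were equal, so the offending row has length a
  -- + 1 and its factor in `ρ` is zero. An empty row below is overtaken only for a = 0.
  ρ-unfit : ∀ a r → Linked _≥_ (a ∷ r) → All (λ μ → ¬ T (fits a μ) → ρ a μ ≡ 0ℚ) (adds r)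
  ρ-unfit zero    []      _         = (λ _ → refl) ∷ []
  ρ-unfit (suc a) []      _         = (λ ¬fits → contradiction _ ¬fits) ∷ []
  ρ-unfit a       (b ∷ r) (a≥b ∷ l) = unfit ∷ All.map⁺ (All.universal (λ _ ¬fits → contradiction (ℕₚ.≤⇒≤ᵇ a≥b) ¬fits) _)
    where
    unfit : ¬ T (suc b ≤ᵇ a) → ρ a (suc b ∷ r) ≡ 0ℚ
    unfit ¬fits with refl ← ℕₚ.≤-antisym a≥b (ℕₚ.≮⇒≥ (¬fits ∘ ℕₚ.≤⇒≤ᵇ)) = ρ-∷-overhang a r

  adds-Σ⁺ : ∀ g λs → Linked _≥_ λs → sumℚ (map (λ μ → g μ * h μ) (adds λs)) ≡ Σ⁺ (λ μ _ → g μ * h μ) λs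
  adds-Σ⁺ g []      _ = +-identityʳ _
  adds-Σ⁺ g (a ∷ r) l = cong (λ y → g (suc a ∷ r) * h (suc a ∷ r) + y) (begin
    sumℚ (map (λ μ → g μ * h μ) (map (a ∷_) (filterᵇ (fits a) (adds r))))
      ≡⟨ cong sumℚ (sym (map-∘ (filterᵇ (fits a) (adds r)))) ⟩
    sumℚ (map (λ μ → g (a ∷ μ) * (ρ a μ * h μ)) (filterᵇ (fits a) (adds r)))
      -- Moving the weight of the top row into the test function makes the induction hypothesis
      -- applicable.
      ≡⟨ cong sumℚ (map-cong (λ μ → sym (*-assoc (g (a ∷ μ)) (ρ a μ) (h μ))) (filterᵇ (fits a) (adds r))) ⟩
    sumℚ (map (λ μ → g (a ∷ μ) * ρ a μ * h μ) (filterᵇ (fits a) (adds r)))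
      ≡⟨ sumℚ-filterᵇ (fits a) (λ μ → g (a ∷ μ) * ρ a μ * h μ) (adds r) (All.map vanish (ρ-unfit a r l)) ⟩
    sumℚ (map (λ μ → g (a ∷ μ) * ρ a μ * h μ) (adds r))
      ≡⟨ adds-Σ⁺ (λ μ → g (a ∷ μ) * ρ a μ) r (Linked.tail l) ⟩
    Σ⁺ (λ μ _ → g (a ∷ μ) * ρ a μ * h μ) r
      ≡⟨ Σ⁺-cong r (λ {μ} _ → *-assoc (g (a ∷ μ)) (ρ a μ) (h μ)) ⟩
    Σ⁺ (λ μ _ → g (a ∷ μ) * (ρ a μ * h μ)) r ∎)
    where
    ring : ∀ x y → x * 0ℚ * y ≡ 0ℚ
    ring = solve-∀ ℚ-ring
    vanish : ∀ {μ} → (¬ T (fits a μ) → ρ a μ ≡ 0ℚ) → ¬ T (fits a μ) → g (a ∷ μ) * ρ a μ * h μ ≡ 0ℚ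
    vanish {μ} z ¬fits = trans (cong (λ y → g (a ∷ μ) * y * h μ) (z ¬fits)) (ring (g (a ∷ μ)) (h μ))

  adds-IsPartition : ∀ λs → IsPartition λs → All IsPartition (adds λs)
  adds-IsPartition []      _ = ([-] , s≤s z≤n ∷ []) ∷ []
  adds-IsPartition (a ∷ r) (l , a>0 ∷ pos) =
    (raise l , s≤s z≤n ∷ pos) ∷
    All.map⁺ (All.map cons (All.zip (All.all-filter (T? ∘ fits a) (adds r) ,
                                     All.filter⁺ (T? ∘ fits a) (adds-IsPartition r (Linked.tail l , pos)))))
    where
    raise : ∀ {a r} → Linked _≥_ (a ∷ r) → Linked _≥_ (suc a ∷ r)
    raise [-]       = [-]
    raise (a≥b ∷ l) = ℕₚ.m≤n⇒m≤1+n a≥b ∷ l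
    cons : ∀ {μ} → T (fits a μ) × IsPartition μ → IsPartition (a ∷ μ)
    cons {[]}    (_ , _)         = [-] , a>0 ∷ []
    cons {b ∷ μ} (fit , l , pos) = ℕₚ.≤ᵇ⇒≤ b a fit ∷ l , a>0 ∷ pos

  -- Restricted to partitions, where the agreement of `q̃` with `q` and of `h` with 1 / H is
  -- established.
  Represents : ((ℕ → ℚ) → ℚ) → (List ℕ → ℚ) → Set
  Represents F g = ∀ λs → IsPartition λs → g λs ≡ F (q̃ λs) * h λs

  D-∂ : ∀ F g → Represents F g → ∀ λs → IsPartition λs → D g λs ≡ ∂ F λs
  D-∂ F g rep λs part = cong₂ _-_
    (trans (cong sumℚ (map-cong-All (adds-IsPartition λs part))) (adds-Σ⁺ (F ∘ q̃) λs (proj₁ part)))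
    (rep λs part)
    where
    map-cong-All : ∀ {μs} → All IsPartition μs → map g μs ≡ map (λ μ → F (q̃ μ) * h μ) μs
    map-cong-All []       = refl
    map-cong-All (p ∷ ps) = cong₂ _∷_ (rep _ p) (map-cong-All ps)

  Dpow-span : ∀ n {e d F g} → Poly.Span e d F → Represents F g →
    Σ ((ℕ → ℚ) → ℚ) (λ G → Poly.Span (n ℕ.* 2 ℕ.+ e) d G × Represents G (Dpow n g))
  Dpow-span zero {F = F} span rep = F , span , rep
  Dpow-span (suc n) {g = g} span rep
    with F , spanF , repF ← Dpow-span n span rep
    with G , spanG , eqG ← ∂-span spanF =
    G , spanG , λ λs part → trans (D-∂ F (Dpow n g) repF λs part) (eqG λs)

  mono-↭ : ∀ {δ δ′} s → δ ↭ δ′ → mono δ s ≡ mono δ′ s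
  mono-↭ s ↭.refl        = refl
  mono-↭ s (↭.prep k p)  = cong (s k *_) (mono-↭ s p)
  mono-↭ {δ′ = _ ∷ _ ∷ δ′} s (↭.swap k j p) = trans (cong (λ y → s k * (s j * y)) (mono-↭ s p)) (ring (s k) (s j) (mono δ′ s))
    where
    ring : ∀ x y z → x * (y * z) ≡ y * (x * z)
    ring = solve-∀ ℚ-ring
  mono-↭ s (↭.trans p p′) = trans (mono-↭ s p) (mono-↭ s p′)

  -- Indexing monomials by partitions, and the two claims

  open Sort (Flip.decTotalOrder ℕₚ.≤-decTotalOrder) using (sort; sort-↭; sort-↗)

  positives : List ℕ → List ℕ
  positives = filter (0 ℕ.<?_)

  -- Zero parts may be dropped because q_0 = 1.
  normalise : List ℕ → List ℕ
  normalise δ = sort (positives δ)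

  normalise-IsPartition : ∀ δ → IsPartition (normalise δ)
  normalise-IsPartition δ = sort-↗ (positives δ) ,
    All-resp-↭ (↭-sym (sort-↭ (positives δ))) (All.all-filter (0 ℕ.<?_) δ)

  size-normalise : ∀ δ → size (normalise δ) ≡ size δ
  size-normalise δ = trans (sum-↭ (sort-↭ (positives δ))) (size-positives δ)
    where
    size-positives : ∀ δ → size (positives δ) ≡ size δ
    size-positives []          = refl
    size-positives (zero ∷ δ)  = size-positives δ
    size-positives (suc k ∷ δ) = cong (suc k ℕ.+_) (size-positives δ)

  mono-normalise : ∀ δ s → s 0 ≡ 1ℚ → mono (normalise δ) s ≡ mono δ s
  mono-normalise δ s s₀ = trans (mono-↭ s (sort-↭ (positives δ))) (mono-positives δ)
    where
    mono-positives : ∀ δ → mono (positives δ) s ≡ mono δ s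
    mono-positives []          = refl
    mono-positives (zero ∷ δ)  = trans (mono-positives δ) (sym (trans (cong (_* mono δ s) s₀) (*-identityˡ (mono δ s))))
    mono-positives (suc k ∷ δ) = cong (s (suc k) *_) (mono-positives δ)

  rowPower-0 : ∀ c λs → rowPower c λs 0 ≡ 1ℚ
  rowPower-0 c []      = refl
  rowPower-0 c (a ∷ r) = trans (+-identityˡ (rowPower (c - 1ℚ) r 0)) (rowPower-0 (c - 1ℚ) r)

  qν-h : ∀ ν → Represents (mono ν) (λ μ → qν ν μ /H μ)
  qν-h ν μ (l , _) = trans (/H-h (qν ν μ) μ l) (cong (_* h μ) (qν-mono ν μ l))

  sumℚ-++ : ∀ xs ys → sumℚ (xs ++ ys) ≡ sumℚ xs + sumℚ ys
  sumℚ-++ []       ys = sym (+-identityˡ (sumℚ ys))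
  sumℚ-++ (x ∷ xs) ys = trans (cong (λ y → x + y) (sumℚ-++ xs ys)) (sym (+-assoc x (sumℚ xs) (sumℚ ys)))

  qν-term : List ℕ → Σ (List ℕ) (λ δ → ℚ) → ℚ
  qν-term λs b = proj₂ b * (qν (proj₁ b) λs /H λs)

  -- A partition may occur several times in `bs`; b_δ is then the sum of its coefficients.
  span-expansion : ∀ {e d F} → Poly.Span e d F → Σ (List (Σ (List ℕ) (λ δ → ℚ))) (λ bs →
    All (λ b → IsPartition (proj₁ b) × size (proj₁ b) ℕ.+ e ≤ d) bs ×
    Represents F (λ λs → sumℚ (map (qν-term λs) bs)))
  span-expansion (Poly.none z) = [] , [] , λ λs _ → sym (trans (cong (_* h λs) (z (q̃ λs))) (*-zeroˡ (h λs)))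
  span-expansion {e} {d} {F} (Poly.term b δ l t) =
    (normalise δ , b) ∷ [] ,
    (normalise-IsPartition δ , subst (λ n → n ℕ.+ e ≤ d) (sym (size-normalise δ)) l) ∷ [] ,
    λ λs part → begin
      b * (qν (normalise δ) λs /H λs) + 0ℚ       ≡⟨ +-identityʳ _ ⟩
      b * (qν (normalise δ) λs /H λs)            ≡⟨ cong (b *_) (qν-h (normalise δ) λs part) ⟩
      b * (mono (normalise δ) (q̃ λs) * h λs)     ≡⟨ cong (λ y → b * (y * h λs)) (mono-normalise δ (q̃ λs) (rowPower-0 0ℚ λs)) ⟩
      b * (mono δ (q̃ λs) * h λs)                 ≡⟨ sym (*-assoc b (mono δ (q̃ λs)) (h λs)) ⟩
      b * mono δ (q̃ λs) * h λs                   ≡⟨ cong (_* h λs) (sym (t (q̃ λs))) ⟩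
      F (q̃ λs) * h λs                            ∎
  span-expansion {F = F} (Poly.plus {f} {g} u v t)
    with bs , bounds , eq ← span-expansion u | bs′ , bounds′ , eq′ ← span-expansion v =
    bs ++ bs′ , All.++⁺ bounds bounds′ , λ λs part → begin
      sumℚ (map (qν-term λs) (bs ++ bs′))
        ≡⟨ trans (cong sumℚ (map-++ (qν-term λs) bs bs′)) (sumℚ-++ (map (qν-term λs) bs) (map (qν-term λs) bs′)) ⟩
      sumℚ (map (qν-term λs) bs) + sumℚ (map (qν-term λs) bs′)
        ≡⟨ cong₂ _+_ (eq λs part) (eq′ λs part) ⟩
      f (q̃ λs) * h λs + g (q̃ λs) * h λs
        ≡⟨ sym (ℚₚ.*-distribʳ-+ (h λs) (f (q̃ λs)) (g (q̃ λs))) ⟩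
      (f (q̃ λs) + g (q̃ λs)) * h λs
        ≡⟨ cong (_* h λs) (sym (t (q̃ λs))) ⟩
      F (q̃ λs) * h λs ∎

  mono-span : ∀ ν → Poly.Span 0 (size ν) (mono ν)
  mono-span ν = Poly.term 1ℚ ν (ℕₚ.≤-reflexive (ℕₚ.+-identityʳ (size ν))) (λ s → sym (*-identityˡ (mono ν s)))

  qν-nilpotent : ∀ ν → IsDPolyOfDegreeAtMostHalf (qν ν) (size ν)
  qν-nilpotent ν = r , 2r≤ , λ λs part → vanish (Dpow-span (suc r) (mono-span ν) (qν-h ν)) λs part
    where
    r : ℕ
    r = size ν ℕ./ 2
    2r≤ : 2 ℕ.* r ≤ size ν
    2r≤ = subst₂ _≤_ (ℕₚ.*-comm r 2) (sym (m≡m%n+[m/n]*n (size ν) 2)) (ℕₚ.m≤n+m (r ℕ.* 2) (size ν % 2))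
    -- The remainder modulo 2 is below 2, so r + 1 drops by 2 exceed |ν| and leave no monomial.
    <2r+2 : size ν < suc r ℕ.* 2 ℕ.+ 0
    <2r+2 = subst₂ _<_ (sym (m≡m%n+[m/n]*n (size ν) 2)) (sym (ℕₚ.+-identityʳ (suc r ℕ.* 2)))
      (ℕₚ.+-monoˡ-< (r ℕ.* 2) (m%n<n (size ν) 2))
    vanish : Σ ((ℕ → ℚ) → ℚ) (λ G →
        Poly.Span (suc r ℕ.* 2 ℕ.+ 0) (size ν) G × Represents G (Dpow (suc r) (λ μ → qν ν μ /H μ))) →
      ∀ λs → IsPartition λs → Dpow (suc r) (λ μ → qν ν μ /H μ) λs ≡ 0ℚ
    vanish (G , spanG , rep) λs part =
      trans (rep λs part) (trans (cong (_* h λs) (Poly.span-zero <2r+2 spanG (q̃ λs))) (*-zeroˡ (h λs)))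

  D-qν-expansion : ∀ ν → Σ (List (Σ (List ℕ) (λ δ → ℚ))) (λ bs →
    All (λ b → IsPartition (proj₁ b) × size (proj₁ b) ℕ.+ 2 ≤ size ν) bs ×
    (∀ λs → IsPartition λs → D (λ μ → qν ν μ /H μ) λs ≡ sumℚ (map (qν-term λs) bs)))
  D-qν-expansion ν = expand (Dpow-span 1 (mono-span ν) (qν-h ν))
    where
    expand : Σ ((ℕ → ℚ) → ℚ) (λ G → Poly.Span 2 (size ν) G × Represents G (D (λ μ → qν ν μ /H μ))) →
      Σ (List (Σ (List ℕ) (λ δ → ℚ))) (λ bs →
        All (λ b → IsPartition (proj₁ b) × size (proj₁ b) ℕ.+ 2 ≤ size ν) bs ×
        (∀ λs → IsPartition λs → D (λ μ → qν ν μ /H μ) λs ≡ sumℚ (map (qν-term λs) bs)))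
    expand (G , spanG , rep) with bs , bounds , eq ← span-expansion spanG =
      bs , bounds , λ λs part → trans (rep λs part) (sym (eq λs part))

open import Data.Nat using (_+_)

theorem6p1 : (ν : List ℕ) → IsPartition ν →
    IsDPolyOfDegreeAtMostHalf (qν ν) (size ν)
    × Σ (List (Σ (List ℕ) (λ δ → ℚ))) (λ bs →
    All (λ p → IsPartition (proj₁ p) × size (proj₁ p) + 2 ≤ size ν) bs
    × ((λs : List ℕ) → IsPartition λs →
    D (λ μ → qν ν μ /H μ) λs
    ≡ sumℚ (map (λ p → proj₂ p * (qν (proj₁ p) λs /H λs)) bs)))
theorem6p1 ν _ = qν-nilpotent ν , D-qν-expansion ν
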